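{- Let $T$ be a forest and let $r\leq t$ be positive integers. Then the class $\mathscr C$ of all $(T,K_{r,t})$-free graphs is $\chi_s$-bounded if and only if $r=1$ or $T$ is a subgraph of the $1$-subdivision of a tree.
   Context: All graphs are finite, simple and undirected. A graph is $F$-free if it does not contain $F$ as an induced subgraph; it is $(F_1,F_2)$-free if it is both $F_1$-free and $F_2$-free. The star chromatic number $\chi_s(G)$ is the minimum number of colors in a proper coloring of $G$ such that the union of any two color classes induces a star forest. $\omega(G)$ is the clique number of $G$. A hereditary class $\mathscr C$ (i.e. closed under induced subgraphs) is $\chi_s$-bounded if there is a function $f$ such that $\chi_s(G)\leq f(\omega(G))$ for every $G\in\mathscr C$. The $1$-subdivision of a graph is obtained by subdividing each edge by exactly one new vertex. $K_{r,t}$ is the complete bipartite graph with parts of sizes $r$ and $t$. -}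

module Defs where

open import Data.Empty using (⊥)
open import Data.Fin.Base using (Fin; zero; suc; inject₁; fromℕ; splitAt)
import Data.Fin.Base as Fin
import Data.Fin.Properties as Fin
open import Data.Fin.Subset using (Subset; _∈_; ∣_∣; Nonempty)
open import Data.Fin.Subset.Properties using (_∈?_)
open import Data.List.Base using (List; allFin; cartesianProduct; filter; length; lookup)
open import Data.Nat.Base using (ℕ; _+_; _≤_)
open import Data.Product using (∃-syntax; Σ-syntax; _×_; _,_; proj₁; proj₂)
open import Data.Sum.Base using (_⊎_; inj₁; inj₂)
open import Data.Unit.Base using (⊤; tt)
open import Function.Base using (_on_)
open import Function.Bundles using (_⇔_; _↔_; Inverse)
open import Function.Definitions using (Injective)
open import Level using (0ℓ)
open import Relation.Binary.Core using (Rel)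
open import Relation.Binary.Construct.Closure.ReflexiveTransitive using (Star)
import Relation.Binary.Definitions as B
open import Relation.Binary.PropositionalEquality using (_≡_; _≢_)
open import Relation.Nullary using (¬_; yes; no)
open import Relation.Nullary.Decidable using (_×-dec_; _⊎-dec_)
open import Relation.Unary using (Pred; Decidable)

record Graph : Set₁ where
  infix 4 _~_ _~?_
  field
    order    : ℕ
    _~_      : Rel (Fin order) 0ℓ
    _~?_     : B.Decidable _~_
    ~-sym    : B.Symmetric _~_
    ~-irrefl : ∀ {v} → ¬ (v ~ v)

  V : Set
  V = Fin order

open Graph using (order; V)

infix 4 _⊢_~_
_⊢_~_ : (G : Graph) → Rel (V G) 0ℓ
_⊢_~_ = Graph._~_

-- Up to isomorphism, i.e. as an injective homomorphism.
infix 4 _IsSubgraphOf_ _IsInducedSubgraphOf_ _≅_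
_IsSubgraphOf_ : Rel Graph 0ℓ
H IsSubgraphOf G = Σ[ f ∈ (V H → V G) ]
  Injective _≡_ _≡_ f × (∀ {u v} → H ⊢ u ~ v → G ⊢ f u ~ f v)

_IsInducedSubgraphOf_ : Rel Graph 0ℓ
H IsInducedSubgraphOf G = Σ[ f ∈ (V H → V G) ]
  Injective _≡_ _≡_ f × (∀ u v → H ⊢ u ~ v ⇔ G ⊢ f u ~ f v)

_-Free : Graph → Graph → Set
(F -Free) G = ¬ (F IsInducedSubgraphOf G)

⟨_,_⟩-Free : Graph → Graph → Graph → Set
⟨ F₁ , F₂ ⟩-Free G = (F₁ -Free) G × (F₂ -Free) G

_≅_ : Rel Graph 0ℓ
G ≅ H = Σ[ φ ∈ (V G ↔ V H) ]
  (∀ u v → G ⊢ u ~ v ⇔ H ⊢ Inverse.to φ u ~ Inverse.to φ v)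

-- The subgraph of G induced by the vertices satisfying P; its i-th vertex is
-- the i-th vertex of G satisfying P.
induced : (G : Graph) {P : Pred (V G) 0ℓ} → Decidable P → Graph
induced G P? = record
  { order    = length vs
  ; _~_      = (G ⊢_~_) on lookup vs
  ; _~?_     = λ i j → Graph._~?_ G (lookup vs i) (lookup vs j)
  ; ~-sym    = Graph.~-sym G
  ; ~-irrefl = Graph.~-irrefl G
  }
  where
  vs : List (V G)
  vs = filter P? (allFin (order G))

Reachable : (G : Graph) → Rel (V G) 0ℓ
Reachable G = Star (G ⊢_~_)

IsConnected : Graph → Set
IsConnected G = 1 ≤ order G × (∀ u v → Reachable G u v)

IsComponent : (G : Graph) → Subset (order G) → Set
IsComponent G S = Nonempty S × (∀ {u} → u ∈ S → ∀ v → v ∈ S ⇔ Reachable G u v)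

-- A cycle c₀ , … , cₖ₊₂ of length k + 3.
HasCycle : Graph → Set
HasCycle G = ∃[ k ] Σ[ c ∈ (Fin (3 + k) → V G) ]
  Injective _≡_ _≡_ c
  × (∀ (i : Fin (2 + k)) → G ⊢ c (inject₁ i) ~ c (suc i))
  × G ⊢ c (fromℕ (2 + k)) ~ c zero

IsForest : Graph → Set
IsForest G = ¬ HasCycle G

IsTree : Graph → Set
IsTree G = IsConnected G × IsForest G

-- The graph with parts Fin m and Fin n, both independent, in which i in the
-- first part and j in the second are adjacent when R i j.
module _ {m n : ℕ} (R : Fin m → Fin n → Set) where

  BipartiteAdj : Rel (Fin m ⊎ Fin n) 0ℓ
  BipartiteAdj (inj₁ i) (inj₂ j) = R i j
  BipartiteAdj (inj₂ j) (inj₁ i) = R i j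
  BipartiteAdj (inj₁ _) (inj₁ _) = ⊥
  BipartiteAdj (inj₂ _) (inj₂ _) = ⊥

  bipartite : B.Decidable R → Graph
  bipartite R? = record
    { order    = m + n
    ; _~_      = BipartiteAdj on splitAt m
    ; _~?_     = λ u v → dec (splitAt m u) (splitAt m v)
    ; ~-sym    = λ {u} {v} → symm (splitAt m u) (splitAt m v)
    ; ~-irrefl = λ {v} → irr (splitAt m v)
    }
    where
    dec : B.Decidable BipartiteAdj
    dec (inj₁ i) (inj₂ j) = R? i j
    dec (inj₂ j) (inj₁ i) = R? i j
    dec (inj₁ _) (inj₁ _) = no λ ()
    dec (inj₂ _) (inj₂ _) = no λ ()

    symm : ∀ x y → BipartiteAdj x y → BipartiteAdj y x
    symm (inj₁ _) (inj₂ _) r = r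
    symm (inj₂ _) (inj₁ _) r = r

    irr : ∀ x → ¬ BipartiteAdj x x
    irr (inj₁ _) ()
    irr (inj₂ _) ()

K : ℕ → ℕ → Graph
K r t = bipartite {r} {t} (λ _ _ → ⊤) (λ _ _ → yes tt)

-- Each edge {u , v} is listed exactly once, as (u , v) with u < v.
edges : (G : Graph) → List (V G × V G)
edges G = filter (λ (u , v) → (u Fin.<? v) ×-dec (u ~? v))
                 (cartesianProduct (allFin (order G)) (allFin (order G)))
  where open Graph G using (_~?_)

-- One part consists of the vertices of G, the other of the subdividing
-- vertices, one per edge of G.
1-subdivision : Graph → Graph
1-subdivision G = bipartite
  (λ v e → v ≡ proj₁ (lookup (edges G) e) ⊎ v ≡ proj₂ (lookup (edges G) e))
  (λ v e → (v Fin.≟ proj₁ (lookup (edges G) e)) ⊎-dec (v Fin.≟ proj₂ (lookup (edges G) e)))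

IsClique : (G : Graph) → Subset (order G) → Set
IsClique G S = ∀ {u v} → u ∈ S → v ∈ S → u ≢ v → G ⊢ u ~ v

IsCliqueNumber : Graph → ℕ → Set
IsCliqueNumber G w = (∃[ S ] IsClique G S × ∣ S ∣ ≡ w)
                   × (∀ S → IsClique G S → ∣ S ∣ ≤ w)

-- The single vertex K 1 0 counts as a star.
IsStar : Graph → Set
IsStar G = ∃[ m ] G ≅ K 1 m

IsStarForest : Graph → Set
IsStarForest G = ∀ S → IsComponent G S → IsStar (induced G (_∈? S))

IsProperColoring : (G : Graph) {k : ℕ} → (V G → Fin k) → Set
IsProperColoring G c = ∀ {u v} → G ⊢ u ~ v → c u ≢ c v

IsStarColoring : (G : Graph) {k : ℕ} → (V G → Fin k) → Set
IsStarColoring G c = IsProperColoring G c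
  × (∀ a b → a ≢ b →
       IsStarForest (induced G (λ v → (c v Fin.≟ a) ⊎-dec (c v Fin.≟ b))))

StarColorable : Graph → ℕ → Set
StarColorable G k = Σ[ c ∈ (V G → Fin k) ] IsStarColoring G c

IsStarChromaticNumber : Graph → ℕ → Set
IsStarChromaticNumber G k = StarColorable G k × (∀ j → StarColorable G j → k ≤ j)

-- χₛ(G) ≤ f(ω(G)) for every G in 𝒞, with w = ω(G) and k = χₛ(G): both numbers
-- exist and are unique for every G.
χₛ-Bounded : (Graph → Set) → Set₁
χₛ-Bounded 𝒞 = Σ[ f ∈ (ℕ → ℕ) ] (∀ G → 𝒞 G →
  ∀ w k → IsCliqueNumber G w → IsStarChromaticNumber G k → k ≤ f w)

-- If r ≥ 2, then the 1-subdivisions of complete graphs are K_{r,t}-free with ω ≤ 2, and by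
-- pigeonhole their star chromatic numbers are unbounded, so T is contained in one of them. Then
-- T is bipartite with degrees at most 2 on one side, and as it is a forest it can be built leaf
-- by leaf as an induced subgraph of the 1-subdivision of a tree.
--
-- Conversely, by Ramsey's theorem a (T,K_{r,t})-free graph G of bounded clique number has bounded
-- degree if r = 1, and has no large biclique as a subgraph otherwise. In the second case a tree S
-- whose 1-subdivision contains T is embedded leaf by leaf: pass to a subset in which every vertex
-- v has large degree, thin the neighbourhood of v so that only boundedly many vertices (the heavy
-- ones) are adjacent to a large part of it, colour the graph joining v to its heavy vertices with
-- boundedly many colours, embed the smaller tree in a colour class by induction, and pick the new
-- leaf in the thinned neighbourhood. Failure bounds the parameter that governs the descent. This
-- is done three times: it bounds the chromatic number of G; then, between pairs of colour
-- classes, the least maximal out-degree of an orientation; and then the chromatic number of the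
-- graph on V(G) joining two vertices of the same colour with a common in-neighbour, where the
-- new leaf comes together with a subdivision vertex. The three bounds give a star colouring.

module Submission where

open import Data.Bool.Base using (Bool; true; false; if_then_else_)
open import Data.Bool.Properties using () renaming (_≟_ to _≟ᵇ_)
open import Data.Empty using (⊥; ⊥-elim)
open import Data.Fin.Base using (Fin; zero; suc; toℕ; combine; fromℕ; inject₁; punchIn; punchOut; splitAt; _↑ˡ_; _↑ʳ_)
import Data.Fin.Base as Fin
import Data.Fin.Properties as Fin
open import Data.Fin.Relation.Unary.Top using (view; ‵fromℕ; ‵inject₁)
open import Data.Fin.Subset using (Subset; inside; outside; ∣_∣)
import Data.Fin.Subset as Subset
import Data.Fin.Subset.Properties as Subset
open import Data.List.Base using (List; []; _∷_; _++_; allFin; cartesianProduct; concatMap; filter; length; lookup; map; tabulate)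
open import Data.List.Membership.Propositional using (_∈_; _∉_; find)
import Data.List.Membership.DecPropositional as DecMembership
open import Data.List.Membership.Propositional.Properties
open import Data.List.Properties using (length-filter; filter-notAll; length-++; length-map; length-tabulate)
open import Data.List.Relation.Binary.Subset.Propositional using (_⊆_)
open import Data.List.Relation.Unary.All using ([]; _∷_)
import Data.List.Relation.Unary.All as All
open import Data.List.Relation.Unary.AllPairs using ([]; _∷_)
open import Data.List.Relation.Unary.Any using (here; there)
import Data.List.Relation.Unary.Any as Any
open import Data.List.Relation.Unary.Any.Properties using (lookup-index)
open import Data.List.Relation.Unary.Unique.Propositional using (Unique)
import Data.List.Relation.Unary.Unique.Propositional.Properties as Unique
open import Data.Nat.Base
open import Data.Nat.Properties
open import Data.Product using (∃; ∃-syntax; Σ-syntax; _×_; _,_; proj₁; proj₂)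
open import Data.Sum.Base using (_⊎_; inj₁; inj₂; [_,_]′)
open import Data.Unit.Base using (⊤; tt)
import Data.Vec.Base as Vec
import Data.Vec.Properties as Vec
open import Function.Base using (_∘_; id; case_of_; const)
open import Function.Bundles using (_⇔_; Equivalence; Injection; mk⇔; mk↔ₛ′)
open import Function.Definitions using (Injective)
open import Function.Properties.Inverse using (↔⇒↣)
open import Level using (0ℓ)
open import Relation.Binary.Construct.Closure.ReflexiveTransitive using (ε; _◅_; _◅◅_; gmap; reverse)
open import Relation.Binary.Core using (Rel)
import Relation.Binary.Definitions as B
open import Relation.Binary.PropositionalEquality
open import Relation.Nullary using (¬_; Dec; yes; no; contradiction; does)
open import Relation.Nullary.Decidable using (¬?; _×-dec_; _⊎-dec_; _→-dec_; decidable-stable; ¬¬-excluded-middle; dec-true)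
open import Relation.Unary using (Pred; Decidable)
open import Defs

open Graph using (order; V)
open Equivalence using (to; from)

-- Lists, Ramsey's theorem and greedy colourings

-- Used with one problem per colour class: a tree found in some class ends the search, otherwise all
-- classes obey the bound.
⊎-∀Fin : ∀ {m} {X : Set} {Y : Fin m → Set} → (∀ i → X ⊎ Y i) → X ⊎ (∀ i → Y i)
⊎-∀Fin {zero} f = inj₂ λ ()
⊎-∀Fin {suc m} f with f Fin.zero | ⊎-∀Fin (f ∘ Fin.suc)
... | inj₁ x | _ = inj₁ x
... | inj₂ _ | inj₁ x = inj₁ x
... | inj₂ y | inj₂ ys = inj₂ λ { Fin.zero → y ; (Fin.suc i) → ys i }

unique-∉ : ∀ {A : Set} {x : A} {xs} → Unique (x ∷ xs) → x ∉ xs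
unique-∉ = Unique.Unique[x∷xs]⇒x∉xs

unique-∷ : ∀ {A : Set} {x : A} {xs} → x ∉ xs → Unique xs → Unique (x ∷ xs)
unique-∷ {xs = xs} x∉xs u = All.tabulate (λ { y∈xs refl → x∉xs y∈xs }) ∷ u

module _ {A : Set} where

  module _ {P : Pred A 0ℓ} (P? : Decidable P) where

    length-filter+ : ∀ xs → length xs ≡ length (filter P? xs) + length (filter (¬? ∘ P?) xs)
    length-filter+ [] = refl
    length-filter+ (x ∷ xs) with P? x
    ... | yes _ = cong suc (length-filter+ xs)
    ... | no  _ = trans (cong suc (length-filter+ xs)) (sym (+-suc _ _))

    length-filter-filter : ∀ {Q : Pred A 0ℓ} (Q? : Decidable Q) xs →
      length (filter P? (filter Q? xs)) ≤ length (filter P? xs)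
    length-filter-filter Q? [] = z≤n
    length-filter-filter Q? (x ∷ xs) with does (Q? x)
    length-filter-filter Q? (x ∷ xs) | false with does (P? x)
    ... | true  = m≤n⇒m≤1+n (length-filter-filter Q? xs)
    ... | false = length-filter-filter Q? xs
    length-filter-filter Q? (x ∷ xs) | true with does (P? x)
    ... | true  = s≤s (length-filter-filter Q? xs)
    ... | false = length-filter-filter Q? xs

  -- Union bound: together the entries of `bs` rule out at most `length bs * ℓ` entries of `xs`.
  avoid : ∀ {B : Set} {P : B → Pred A 0ℓ} (P? : ∀ b → Decidable (P b)) {ℓ} bs xs →
    (∀ {b} → b ∈ bs → length (filter (P? b) xs) ≤ ℓ) → length bs * ℓ < length xs →
    ∃[ x ] x ∈ xs × (∀ {b} → b ∈ bs → ¬ P b x)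
  avoid P? [] (x ∷ xs) _ _ = x , here refl , λ ()
  avoid P? {ℓ} (b ∷ bs) xs few long =
    let x , x∈ , away = avoid P? bs ys
          (λ b′∈bs → ≤-trans (length-filter-filter (P? _) (¬? ∘ P? b) xs) (few (there b′∈bs)))
          (+-cancelˡ-< ℓ _ _ (<-≤-trans long (≤-trans (≤-reflexive (length-filter+ (P? b) xs))
            (+-monoˡ-≤ (length ys) (few (here refl))))))
        x∈xs , ¬b = ∈-filter⁻ (¬? ∘ P? b) x∈
    in x , x∈xs , λ { (here refl) → ¬b ; (there b∈) → away b∈ }
    where ys = filter (¬? ∘ P? b) xs

  length-concatMap : ∀ {B : Set} (f : A → List B) {ℓ} → (∀ x → length (f x) ≤ ℓ) →
    ∀ xs → length (concatMap f xs) ≤ length xs * ℓ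
  length-concatMap f short [] = z≤n
  length-concatMap f short (x ∷ xs) = ≤-trans (≤-reflexive (length-++ (f x)))
    (+-mono-≤ (short x) (length-concatMap f short xs))

  ∈-concatMap : ∀ {B : Set} (f : A → List B) {x xs y} → x ∈ xs → y ∈ f x → y ∈ concatMap f xs
  ∈-concatMap f x∈xs y∈fx = ∈-concatMap⁺ f (Any.map (λ { refl → y∈fx }) x∈xs)

  lookup-unique : ∀ {xs : List A} → Unique xs → ∀ {i j} → lookup xs i ≡ lookup xs j → i ≡ j
  lookup-unique (_ ∷ _) {Fin.zero} {Fin.zero} _ = refl
  lookup-unique u@(_ ∷ _) {Fin.zero} {Fin.suc j} eq = contradiction (subst (_∈ _) (sym eq) (∈-lookup j)) (unique-∉ u)
  lookup-unique u@(_ ∷ _) {Fin.suc i} {Fin.zero} eq = contradiction (subst (_∈ _) eq (∈-lookup i)) (unique-∉ u)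
  lookup-unique (_ ∷ u) {Fin.suc i} {Fin.suc j} eq = cong Fin.suc (lookup-unique u eq)

module _ {n : ℕ} where
  open DecMembership (Fin._≟_ {n}) using (_∈?_) public

  infixl 6 _∖_
  _∖_ : List (Fin n) → Fin n → List (Fin n)
  xs ∖ v = filter (λ x → ¬? (x Fin.≟ v)) xs

  ∈-∖⁺ : ∀ {xs v x} → x ∈ xs → x ≢ v → x ∈ xs ∖ v
  ∈-∖⁺ = ∈-filter⁺ _

  length-∖ : ∀ {xs v} → v ∈ xs → length (xs ∖ v) < length xs
  length-∖ {xs} v∈xs = filter-notAll _ xs (Any.map (λ { refl ¬p → ¬p refl }) v∈xs)

  ⊆⇒length≤ : ∀ {xs ys : List (Fin n)} → Unique xs → xs ⊆ ys → length xs ≤ length ys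
  ⊆⇒length≤ {[]} _ _ = z≤n
  ⊆⇒length≤ {x ∷ xs} u@(_ ∷ u′) xs⊆ys = ≤-trans
    (s≤s (⊆⇒length≤ u′ λ {y} y∈xs → ∈-∖⁺ (xs⊆ys (there y∈xs)) λ { refl → unique-∉ u y∈xs }))
    (length-∖ (xs⊆ys (here refl)))

  filter-∈-length : ∀ {xs} ys → Unique xs → length (filter (_∈? ys) xs) ≤ length ys
  filter-∈-length {xs} ys u = ⊆⇒length≤ (Unique.filter⁺ (_∈? ys) u)
    (λ x∈ → proj₂ (∈-filter⁻ (_∈? ys) {xs = xs} x∈))

  fresh : ∀ (xs : List (Fin n)) → length xs < n → ∃[ x ] x ∉ xs
  fresh xs short with Fin.any? (λ x → ¬? (x ∈? xs))
  ... | yes p = p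
  ... | no ¬p = contradiction short (≤⇒≯ (subst (_≤ length xs) (length-tabulate {n = n} id)
    (⊆⇒length≤ (Unique.allFin⁺ n) λ {x} _ → decidable-stable (x ∈? xs) λ x∉ → ¬p (x , x∉))))

repeated : ∀ {A : Set} {k} (c : A → Fin k) {xs : List A} → Unique xs → k < length xs →
  ∃[ x ] ∃[ y ] x ∈ xs × y ∈ xs × x ≢ y × c x ≡ c y
repeated c {xs} u long with i , j , i<j , eq ← Fin.pigeonhole long (c ∘ lookup xs) =
  lookup xs i , lookup xs j , ∈-lookup i , ∈-lookup j , (λ p → Fin.<⇒≢ i<j (lookup-unique u p)) , eq

-- The Erdős-Szekeres recursion, started at 0 because the empty list is homogeneous of both kinds.
ramsey-bound : ℕ → ℕ → ℕ
ramsey-bound zero    b       = 0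
ramsey-bound (suc a) zero    = 0
ramsey-bound (suc a) (suc b) = suc (ramsey-bound a (suc b) + ramsey-bound (suc a) b)

module _ {A : Set} {E : Rel A 0ℓ} (E? : B.Decidable E) (E-sym : B.Symmetric E) where

  Homogeneous : Rel A 0ℓ → List A → ℕ → Set
  Homogeneous R xs k = ∃[ ys ] length ys ≡ k × Unique ys × ys ⊆ xs
    × (∀ {x y} → x ∈ ys → y ∈ ys → x ≢ y → R x y)

  private
    weaken : ∀ {R xs ys k} → xs ⊆ ys → Homogeneous R xs k → Homogeneous R ys k
    weaken xs⊆ys (zs , len , u , zs⊆xs , h) = zs , len , u , xs⊆ys ∘ zs⊆xs , h

    extend : ∀ {R : Rel A 0ℓ} → B.Symmetric R → ∀ {x xs ys k} → x ∉ xs → ys ⊆ xs → (∀ {y} → y ∈ ys → R x y) →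
      Homogeneous R ys k → Homogeneous R (x ∷ xs) (suc k)
    extend R-sym {x} x∉xs ys⊆xs Rx (zs , len , u , zs⊆ys , h) =
      x ∷ zs , cong suc len , unique-∷ (x∉xs ∘ ys⊆xs ∘ zs⊆ys) u ,
      (λ { (here refl) → here refl ; (there p) → there (ys⊆xs (zs⊆ys p)) }) ,
      λ { (here refl) (here refl) ne → contradiction refl ne
        ; (here refl) (there q) _ → Rx (zs⊆ys q)
        ; (there p) (here refl) _ → R-sym (Rx (zs⊆ys p))
        ; (there p) (there q) ne → h p q ne }

  ramsey : ∀ a b xs → Unique xs → ramsey-bound a b ≤ length xs →
    Homogeneous E xs a ⊎ Homogeneous (λ x y → ¬ E x y) xs b
  ramsey zero b xs u long = inj₁ ([] , refl , [] , (λ ()) , λ ())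
  ramsey (suc a) zero xs u long = inj₂ ([] , refl , [] , (λ ()) , λ ())
  ramsey (suc a) (suc b) (x ∷ xs) u@(_ ∷ u′) (s≤s long)
    with ramsey-bound a (suc b) ≤? length (filter (E? x) xs)
  ... | yes many with ramsey a (suc b) (filter (E? x) xs) (Unique.filter⁺ (E? x) u′) many
  ...   | inj₁ h = inj₁ (extend E-sym (unique-∉ u) (proj₁ ∘ ∈-filter⁻ (E? x)) (proj₂ ∘ ∈-filter⁻ (E? x) {xs = xs}) h)
  ...   | inj₂ h = inj₂ (weaken (there ∘ proj₁ ∘ ∈-filter⁻ (E? x)) h)
  ramsey (suc a) (suc b) (x ∷ xs) u@(_ ∷ u′) (s≤s long) | no few
    with ramsey (suc a) b (filter (¬? ∘ E? x) xs) (Unique.filter⁺ (¬? ∘ E? x) u′)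
           (≮⇒≥ λ few′ → <⇒≱ (+-mono-<-≤ (≰⇒> few) (<⇒≤ few′))
             (subst (_ ≤_) (length-filter+ (E? x) xs) long))
  ...   | inj₁ h = inj₁ (weaken (there ∘ proj₁ ∘ ∈-filter⁻ (¬? ∘ E? x)) h)
  ...   | inj₂ h = inj₂ (extend (λ ¬e e → ¬e (E-sym e)) (unique-∉ u) (proj₁ ∘ ∈-filter⁻ (¬? ∘ E? x))
                     (proj₂ ∘ ∈-filter⁻ (¬? ∘ E? x) {xs = xs}) h)

-- Growing trees and the induction on them

-- grow T p attaches a new vertex, numbered 0, at vertex p by a new edge, also numbered 0; the
-- numbers of the old vertices and edges are shifted by one.
data RootedTree : ℕ → Set where
  root : RootedTree 0
  grow : ∀ {m} → RootedTree m → Fin (suc m) → RootedTree (suc m)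

module _ {n : ℕ} {H : Rel (Fin n) 0ℓ} (H? : B.Decidable H) where

  degree : List (Fin n) → Fin n → ℕ
  degree S v = length (filter (H? v) S)

  -- Vertices of degree below `k` are deleted one at a time, and `Q` is carried back along the
  -- deletions. What remains may be empty.
  core : ∀ k (Q : List (Fin n) → Set) →
    (∀ S {v} → v ∈ S → degree S v < k → Q (S ∖ v) → Q S) → ∀ S →
    ∃[ S′ ] S′ ⊆ S × (Unique S → Unique S′) × (∀ {v} → v ∈ S′ → k ≤ degree S′ v) × (Q S′ → Q S)
  core k Q add S = go (length S) S ≤-refl
    where
    go : ∀ m S → length S ≤ m →
      ∃[ S′ ] S′ ⊆ S × (Unique S → Unique S′) × (∀ {v} → v ∈ S′ → k ≤ degree S′ v) × (Q S′ → Q S)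
    go m S bound with Any.any? (λ v → degree S v <? k) S
    ... | no ¬p = S , id , id , (λ v∈S → ≮⇒≥ λ low → ¬p (Any.map (λ { refl → low }) v∈S)) , id
    ... | yes p with v , v∈S , low ← find p with m
    ...   | zero = contradiction (∈-length v∈S) (<⇒≱ (s≤s bound))
    ...   | suc m with S′ , S′⊆ , u , high , up ← go m (S ∖ v) (s≤s⁻¹ (<-≤-trans (length-∖ v∈S) bound)) =
      S′ , proj₁ ∘ ∈-filter⁻ _ ∘ S′⊆ , u ∘ Unique.filter⁺ _ , high , add S v∈S low ∘ up

module _ {n : ℕ} {d : ℕ} (out : Fin n → List (Fin n)) (short : ∀ v → length (out v) ≤ d) where

  -- Vertices are coloured in order of rank, those of equal rank simultaneously. Each avoids the
  -- current colours of its at most `d` out-neighbours; arcs within a rank impose nothing.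
  greedy : (ρ : Fin n → ℕ) → ∀ m → (∀ v → ρ v < m) →
    Σ[ c ∈ (Fin n → Fin (suc d)) ] (∀ {u v} → u ∈ out v → ρ u < ρ v → c u ≢ c v)
  greedy ρ m bound = let c , good = go m in c , λ {_} {v} → good (bound v)
    where
    go : ∀ m → Σ[ c ∈ (Fin n → Fin (suc d)) ]
      (∀ {u v} → ρ v < m → u ∈ out v → ρ u < ρ v → c u ≢ c v)
    go zero = (λ _ → zero) , λ ()
    go (suc m) with c , good ← go m = c′ , good′
      where
      new : ∀ v → ∃[ x ] x ∉ map c (out v)
      new v = fresh (map c (out v)) (s≤s (subst (_≤ d) (sym (length-map c (out v))) (short v)))
      c′ : Fin n → Fin (suc d)
      c′ v with ρ v ≟ m
      ... | yes _ = proj₁ (new v)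
      ... | no  _ = c v
      good′ : ∀ {u v} → ρ v < suc m → u ∈ out v → ρ u < ρ v → c′ u ≢ c′ v
      good′ {u} {v} v<1+m u∈ u<v with ρ u ≟ m | ρ v ≟ m
      ... | yes refl | _ = contradiction u<v (≤⇒≯ (s≤s⁻¹ v<1+m))
      ... | no _ | yes refl = λ eq → proj₂ (new v) (subst (_∈ _) eq (∈-map⁺ c u∈))
      ... | no _ | no v≢m = good (≤∧≢⇒< (s≤s⁻¹ v<1+m) v≢m) u∈ u<v

  -- Arcs that go up in the order of Fin n and arcs that go down are coloured
  -- separately, and each greedily.
  digraph-coloring : Σ[ c ∈ (Fin n → Fin (suc d * suc d)) ] (∀ {u v} → u ∈ out v → u ≢ v → c u ≢ c v)
  digraph-coloring
    with c₁ , good₁ ← greedy toℕ n Fin.toℕ<n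
    -- The reversed rank takes the value `n` at the vertex 0, hence the bound `suc n`.
    with c₂ , good₂ ← greedy (λ v → n ∸ toℕ v) (suc n) (λ v → s≤s (m∸n≤m n (toℕ v))) =
    (λ v → combine (c₁ v) (c₂ v)) , good
    where
    good : ∀ {u v} → u ∈ out v → u ≢ v → combine (c₁ u) (c₂ u) ≢ combine (c₁ v) (c₂ v)
    good {u} {v} u∈ u≢v eq with <-cmp (toℕ u) (toℕ v)
    ... | B.tri< u<v _ _ = good₁ u∈ u<v (Fin.combine-injectiveˡ (c₁ u) (c₂ u) (c₁ v) (c₂ v) eq)
    ... | B.tri≈ _ u≡v _ = u≢v (Fin.toℕ-injective u≡v)
    ... | B.tri> _ _ v<u = good₂ u∈ (∸-monoʳ-< v<u (Fin.toℕ≤n u))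
                            (Fin.combine-injectiveʳ (c₁ u) (c₂ u) (c₁ v) (c₂ v) eq)

-- The size needed with `j` rounds of `thin` to go. If no further vertex is related to as many
-- elements as the next size, `s` vertices spoil at most `s * (load + e)` elements and one is left
-- over. With no round to go, `t` elements must remain to form a biclique.
fan-size : (s e t : ℕ) → ℕ → ℕ
fan-size s e t zero    = t
fan-size s e t (suc j) = suc (s * (fan-size s e t j + e))

-- The biclique need not be induced, and `W` need not be an adjacency relation: for siblings it is
-- `Blocks v`.
Biclique-free : ∀ {n} {A : Set} → (Fin n → A → Set) → ℕ → Set
Biclique-free W t = ∀ R M → Unique R → Unique M → t ≤ length R → t ≤ length M →
  ¬ (∀ {w x} → w ∈ R → x ∈ M → W w x)

module _ {n : ℕ} {A : Set} {W : Fin n → A → Set} (W? : ∀ w → Decidable (W w)) where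

  record Thinned (s e t : ℕ) (N : List A) : Set where
    field
      heavy        : List (Fin n)
      fan          : List A
      load         : ℕ
      heavy-length : length heavy ≤ t
      fan-unique   : Unique fan
      fan⊆         : fan ⊆ N
      light        : ∀ {w} → w ∉ heavy → length (filter (W? w) fan) ≤ load
      fan-long     : s * (load + e) < length fan

  -- Each round moves into the fan of a vertex related to a large part of it; these
  -- vertices are related to all that is left, so that there are fewer than t rounds.
  thin : ∀ s e t → Biclique-free W t →
    ∀ N → Unique N → fan-size s e t t ≤ length N → Thinned s e t N
  thin s e t free = λ N u long → go t N [] refl [] u long λ ()
    where
    size = fan-size s e t
    go : ∀ j N R → length R + j ≡ t → Unique R → Unique N → size j ≤ length N →
      (∀ {w x} → w ∈ R → x ∈ N → W w x) → Thinned s e t N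
    go zero N R len uR uN long rel =
      ⊥-elim (free R N uR uN (≤-reflexive (sym (trans (sym (+-identityʳ _)) len))) long rel)
    go (suc j) N R len uR uN long rel
      with Fin.any? (λ w → ¬? (w ∈? R) ×-dec (size j ≤? length (filter (W? w) N)))
    ... | no ¬p = record
      { heavy = R ; fan = N ; load = size j
      ; heavy-length = ≤-trans (m≤m+n _ _) (≤-reflexive len)
      ; fan-unique = uN ; fan⊆ = id
      ; light = λ w∉R → <⇒≤ (≰⇒> λ many → ¬p (_ , w∉R , many))
      ; fan-long = long }
    ... | yes (w , w∉R , many) = record
      { heavy = heavy ; fan = fan ; load = load ; heavy-length = heavy-length
      ; fan-unique = fan-unique ; fan⊆ = proj₁ ∘ ∈-filter⁻ (W? w) ∘ fan⊆
      ; light = light ; fan-long = fan-long }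
      where
      rest : Thinned s e t (filter (W? w) N)
      rest = go j (filter (W? w) N) (w ∷ R) (trans (sym (+-suc _ j)) len) (unique-∷ w∉R uR)
        (Unique.filter⁺ (W? w) uN) many
        λ { (here refl) x∈ → proj₂ (∈-filter⁻ (W? w) {xs = N} x∈)
          ; (there w∈) x∈ → rel w∈ (proj₁ (∈-filter⁻ (W? w) x∈)) }
      open Thinned rest

-- The first entry of the maximum is the degree from which a neighbourhood can be thinned;
-- `suc (m + m)` counts the vertices and edges of `T`. In the second, the number of colours is that
-- of `digraph-coloring` for the hulls of at most `t` heavy vertices, which have at most `t * η`
-- elements.
growth-bound : (t η e : ℕ) (split : ℕ → ℕ → ℕ) → ∀ {m} → RootedTree m → ℕ
growth-bound t η e split root = 1
growth-bound t η e split (grow {m} T p) =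
  fan-size (suc (m + m)) e t t ⊔ split (suc (t * η) * suc (t * η)) (growth-bound t η e split T)

-- The data of an induction that embeds rooted trees leaf by leaf: H v u says that u may be
-- attached at v, and W v w u that the vertex w obstructs this. Q M S is the conclusion, with
-- bound M, for the sets S that contain no copy of the tree. Only Link-ed
-- vertices have to be separated by Q-split: in the bipartite case, those on the same side.
record GrowthSystem (n t η e : ℕ) (split : ℕ → ℕ → ℕ) : Set₁ where
  field
    H        : Rel (Fin n) 0ℓ
    H?       : B.Decidable H
    W        : Fin n → Rel (Fin n) 0ℓ
    W?       : ∀ v → B.Decidable (W v)
    W-free   : ∀ v → Biclique-free (W v) t
    hull     : Fin n → List (Fin n)
    hull-length : ∀ v → length (hull v) ≤ η
    Ok       : List (Fin n) → Set
    Ok-⊆     : ∀ {S S′} → S′ ⊆ S → Ok S → Ok S′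
    Link     : Rel (Fin n) 0ℓ
    Q        : ℕ → List (Fin n) → Set
    Q-empty  : Q 1 []
    Q-mono   : ∀ {M M′ S} → M ≤ M′ → Q M S → Q M′ S
    Q-add    : ∀ {M S v} → v ∈ S → degree H? S v < M → Q M (S ∖ v) → Q M S
    Q-split  : ∀ {X : Set} {m M S} → Ok S → (c : Fin n → Fin m) →
               (∀ S″ → S″ ⊆ S → (Unique S → Unique S″) →
                 (∀ {u v} → u ∈ S″ → v ∈ S″ → Link u v → c u ≡ c v) → X ⊎ Q M S″) →
               X ⊎ Q (split m M) S
    Conf     : ∀ {m} → RootedTree m → List (Fin n) → Set
    Conf-⊆   : ∀ {m} {T : RootedTree m} {S S′} → S′ ⊆ S → Conf T S′ → Conf T S
    Conf-root : ∀ {v S} → v ∈ S → Conf root S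
    spot     : ∀ {m} {T : RootedTree m} {S} → Conf T S → Fin (suc m) → Fin n
    spot∈    : ∀ {m} {T : RootedTree m} {S} (C : Conf T S) p → spot C p ∈ S
    attach   : ∀ {m} {T : RootedTree m} {S S″ R N τ} (C : Conf T S″) p → Ok S → S″ ⊆ S →
               N ⊆ S → Unique N → (∀ {u} → u ∈ N → H (spot C p) u) →
               (∀ {w} → w ∉ R → length (filter (W? (spot C p) w) N) ≤ τ) →
               (∀ {u} → u ∈ S″ → u ≢ spot C p → Link u (spot C p) → u ∉ concatMap hull R) →
               suc (m + m) * (τ + e) < length N → Conf (grow T p) S

module _ {n t η e split} (𝒢 : GrowthSystem n t η e split) where
  open GrowthSystem 𝒢

  private bound = growth-bound t η e split

  -- Induction on the tree. In the core every neighbourhood can be thinned, and the colouring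
  -- separates each vertex from the hulls of its heavy vertices. So if some class contains a copy of
  -- `T`, no vertex of it linked to the spot lies in those hulls, and the leaf can be attached; if
  -- none does, `Q-split` combines the bounds.
  grows : ∀ {m} (T : RootedTree m) S → Unique S → Ok S → Conf T S ⊎ Q (bound T) S
  grows root [] _ _ = inj₂ Q-empty
  grows root (v ∷ S) _ _ = inj₁ (Conf-root (here refl))
  grows T₊@(grow {m} T p) S uS okS
    with S′ , S′⊆S , uS′ , high , up ← core H? (fan-size (suc (m + m)) e t t) (Q (bound T₊))
      (λ _ v∈ low → Q-add v∈ (<-≤-trans low (m≤m⊔n _ _))) S =
    result
    where
    okS′ = Ok-⊆ S′⊆S okS
    u′ = uS′ uS

    thinned : ∀ v → v ∈ S′ → Thinned (W? v) (suc (m + m)) e t (filter (H? v) S′)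
    thinned v v∈ = thin (W? v) _ e t (W-free v) _ (Unique.filter⁺ (H? v) u′) (high v∈)

    -- The colouring needs a list at every vertex; outside `S′` the empty one serves.
    R : Fin n → List (Fin n)
    R v with v ∈? S′
    ... | yes v∈ = Thinned.heavy (thinned v v∈)
    ... | no  _  = []

    -- The thinned fan depends on the membership proof, so the one whose heavy list is `R v` is
    -- recovered together with that equality.
    R-thinned : ∀ v → v ∈ S′ → Σ[ th ∈ Thinned (W? v) (suc (m + m)) e t (filter (H? v) S′) ] Thinned.heavy th ≡ R v
    R-thinned v v∈ with v ∈? S′
    ... | yes v∈′ = thinned v v∈′ , refl
    ... | no v∉ = contradiction v∈ v∉

    R-length : ∀ v → length (R v) ≤ t
    R-length v with v ∈? S′
    ... | yes v∈ = Thinned.heavy-length (thinned v v∈)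
    ... | no _ = z≤n

    coloring = digraph-coloring (λ v → concatMap hull (R v))
      (λ v → ≤-trans (length-concatMap hull hull-length (R v)) (*-monoˡ-≤ η (R-length v)))
    c = proj₁ coloring

    branch : ∀ S″ → S″ ⊆ S′ → (Unique S′ → Unique S″) →
      (∀ {u v} → u ∈ S″ → v ∈ S″ → Link u v → c u ≡ c v) → Conf T₊ S′ ⊎ Q (bound T) S″
    branch S″ S″⊆S′ uS″ same with grows T S″ (uS″ u′) (Ok-⊆ S″⊆S′ okS′)
    ... | inj₂ q = inj₂ q
    ... | inj₁ C with R-thinned (spot C p) (S″⊆S′ (spot∈ C p))
    ...   | th , eq = inj₁ (attach C p okS′ S″⊆S′
              (proj₁ ∘ ∈-filter⁻ (H? _) ∘ fan⊆) fan-unique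
              (λ u∈ → proj₂ (∈-filter⁻ (H? _) {xs = S′} (fan⊆ u∈))) light
              (λ {u} u∈ u≢v link u∈R → proj₂ coloring (subst (λ r → u ∈ concatMap hull r) eq u∈R) u≢v
                (same u∈ (spot∈ C p) link))
              fan-long)
            where open Thinned th

    result : Conf T₊ S ⊎ Q (bound T₊) S
    result with Q-split okS′ c branch
    ... | inj₁ C = inj₁ (Conf-⊆ S′⊆S C)
    ... | inj₂ q = inj₂ (up (Q-mono (m≤n⊔m (fan-size (suc (m + m)) e t t) _) q))

-- Choosing a leaf, colourings, orientations and induced trees

module _ {A : Set} {P Q : Pred A 0ℓ} (P? : Decidable P) (Q? : Decidable Q) where

  length-filter-mono : ∀ xs → (∀ {x} → x ∈ xs → P x → Q x) → length (filter P? xs) ≤ length (filter Q? xs)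
  length-filter-mono [] _ = z≤n
  length-filter-mono (x ∷ xs) P⊆Q with P? x | Q? x
  ... | yes p | no ¬q = contradiction (P⊆Q (here refl) p) ¬q
  ... | yes _ | yes _ = s≤s (length-filter-mono xs (P⊆Q ∘ there))
  ... | no  _ | yes _ = m≤n⇒m≤1+n (length-filter-mono xs (P⊆Q ∘ there))
  ... | no  _ | no  _ = length-filter-mono xs (P⊆Q ∘ there)

  length-filter-⊎ : ∀ xs → length (filter (λ x → P? x ⊎-dec Q? x) xs) ≤ length (filter P? xs) + length (filter Q? xs)
  length-filter-⊎ [] = z≤n
  length-filter-⊎ (x ∷ xs) with P? x | Q? x
  ... | yes _ | yes _ = s≤s (≤-trans (length-filter-⊎ xs) (+-monoʳ-≤ _ (n≤1+n _)))
  ... | yes _ | no  _ = s≤s (length-filter-⊎ xs)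
  ... | no  _ | yes _ = ≤-trans (s≤s (length-filter-⊎ xs)) (≤-reflexive (sym (+-suc _ _)))
  ... | no  _ | no  _ = length-filter-⊎ xs

-- An empty filter is short anyway, so the bound may be proved from a witness of `P`. Such a witness
-- later provides a neighbour in `N`, or the fact that `w` is not the spot.
length-filter-≤ : ∀ {A : Set} {P : Pred A 0ℓ} (P? : Decidable P) xs {k} →
  (∀ {x} → x ∈ xs → P x → length (filter P? xs) ≤ k) → length (filter P? xs) ≤ k
length-filter-≤ P? xs few with filter P? xs in eq
... | [] = z≤n
... | y ∷ ys = let y∈ , py = ∈-filter⁻ P? {xs = xs} (subst (y ∈_) (sym eq) (here refl)) in few y∈ py

-- Every `w` in `ws` spoils at most `τ` candidates through `W` and at most `e` through its exclusion
-- list. In the applications `v` is related to all candidates, so it is exempt from the first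
-- condition.
pick : ∀ {n} {W : Rel (Fin n) 0ℓ} (W? : B.Decidable W) (excluded : Fin n → List (Fin n)) {e τ} →
  (∀ w → length (excluded w) ≤ e) → ∀ v ws N → Unique N →
  (∀ {w} → w ∈ ws → w ≢ v → length (filter (W? w) N) ≤ τ) → length ws * (τ + e) < length N →
  ∃[ u ] u ∈ N × (∀ {w} → w ∈ ws → w ≢ v → ¬ W w u) × (∀ {w} → w ∈ ws → u ∉ excluded w)
pick {n} {W} W? excluded {e} {τ} short v ws N uN light long =
  let u , u∈N , away = avoid bad? ws N few long
  in u , u∈N , (λ w∈ w≢v r → away w∈ (inj₁ (w≢v , r))) , λ w∈ u∈ → away w∈ (inj₂ u∈)
  where
  off? : B.Decidable (λ w u → w ≢ v × W w u)
  off? w u = ¬? (w Fin.≟ v) ×-dec W? w u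
  bad? : B.Decidable (λ w u → w ≢ v × W w u ⊎ u ∈ excluded w)
  bad? w u = off? w u ⊎-dec (u ∈? excluded w)
  few : ∀ {w} → w ∈ ws → length (filter (bad? w) N) ≤ τ + e
  few {w} w∈ = ≤-trans (length-filter-⊎ (off? w) (_∈? excluded w) N) (+-mono-≤
    (length-filter-≤ (off? w) N λ _ (w≢v , _) →
      ≤-trans (length-filter-mono (off? w) (W? w) N (λ _ → proj₂)) (light w∈ w≢v))
    (≤-trans (filter-∈-length (excluded w) uN) (short w)))

module _ {n : ℕ} where

  Colorable : Rel (Fin n) 0ℓ → ℕ → List (Fin n) → Set
  Colorable H M S = Σ[ c ∈ (Fin n → Fin M) ] (∀ {u v} → u ∈ S → v ∈ S → H u v → c u ≢ c v)

  module _ {H : Rel (Fin n) 0ℓ} where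

    colorable-empty : Colorable H 1 []
    colorable-empty = const zero , λ ()

    colorable-mono : ∀ {M M′ S} → M ≤ M′ → Colorable H M S → Colorable H M′ S
    colorable-mono M≤M′ (c , good) = (λ v → Fin.inject≤ (c v) M≤M′) ,
      λ u∈ v∈ h eq → good u∈ v∈ h (Fin.inject≤-injective M≤M′ M≤M′ _ _ eq)

    colorable-add : (H? : B.Decidable H) → B.Symmetric H → B.Irreflexive _≡_ H →
      ∀ {M S v} → v ∈ S → degree H? S v < M → Colorable H M (S ∖ v) → Colorable H M S
    colorable-add H? H-sym H-irrefl {M} {S} {v} v∈S low (c , good) = c′ , good′
      where
      new : ∃[ x ] x ∉ map c (filter (H? v) S)
      new = fresh _ (subst (_< M) (sym (length-map c (filter (H? v) S))) low)
      new≢ : ∀ {u} → u ∈ S → H v u → proj₁ new ≢ c u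
      new≢ u∈ h eq = proj₂ new (subst (_∈ _) (sym eq) (∈-map⁺ c (∈-filter⁺ (H? v) u∈ h)))
      c′ : Fin n → Fin M
      c′ u with u Fin.≟ v
      ... | yes _ = proj₁ new
      ... | no  _ = c u
      good′ : ∀ {u w} → u ∈ S → w ∈ S → H u w → c′ u ≢ c′ w
      good′ {u} {w} u∈ w∈ h with u Fin.≟ v | w Fin.≟ v
      ... | yes refl | yes refl = contradiction h (H-irrefl refl)
      ... | yes refl | no _ = new≢ w∈ h
      ... | no _ | yes refl = λ eq → new≢ u∈ (H-sym h) (sym eq)
      ... | no u≢v | no w≢v = good (∈-∖⁺ u∈ u≢v) (∈-∖⁺ w∈ w≢v) h

    colorable-split : ∀ {X : Set} {m M S} (c : Fin n → Fin m) →
      (∀ S″ → S″ ⊆ S → (Unique S → Unique S″) → (∀ {u v} → u ∈ S″ → v ∈ S″ → c u ≡ c v) → X ⊎ Colorable H M S″) →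
      X ⊎ Colorable H (m * M) S
    colorable-split {X} {m} {M} {S} c solve with ⊎-∀Fin {X = X} (λ i → solve (class i)
        (proj₁ ∘ ∈-filter⁻ _) (Unique.filter⁺ _) λ u∈ v∈ → trans (col u∈) (sym (col v∈)))
      where
      class : Fin m → List (Fin n)
      class i = filter (λ u → c u Fin.≟ i) S
      col : ∀ {i u} → u ∈ class i → c u ≡ i
      col u∈ = proj₂ (∈-filter⁻ _ {xs = S} u∈)
    ... | inj₁ x = inj₁ x
    ... | inj₂ q = inj₂ ((λ v → combine (c v) (proj₁ (q (c v)) v)) , λ {u} {v} u∈ v∈ h eq →
      let cu≡cv = Fin.combine-injectiveˡ (c u) _ (c v) _ eq in
      proj₂ (q (c v)) (∈-filter⁺ _ u∈ cu≡cv) (∈-filter⁺ _ v∈ refl) h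
        (trans (cong (λ i → proj₁ (q i) u) (sym cu≡cv)) (Fin.combine-injectiveʳ (c u) _ (c v) _ eq)))

TreeAdj : ∀ {m} → RootedTree m → Rel (Fin (suc m)) 0ℓ
TreeAdj root       _       _       = ⊥
TreeAdj (grow T p) zero    zero    = ⊥
TreeAdj (grow T p) zero    (suc j) = j ≡ p
TreeAdj (grow T p) (suc i) zero    = i ≡ p
TreeAdj (grow T p) (suc i) (suc j) = TreeAdj T i j

same-side : ∀ {a b c : Bool} → a ≢ c → b ≢ c → a ≡ b
same-side {false} {false} _ _ = refl
same-side {true} {true} _ _ = refl
same-side {false} {true} {false} p _ = contradiction refl p
same-side {false} {true} {true} _ q = contradiction refl q
same-side {true} {false} {false} _ q = contradiction refl q
same-side {true} {false} {true} p _ = contradiction refl p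

-- The two entries 1: the hull of a vertex is the vertex itself, and a new leaf merely has to differ
-- from each placed vertex.
colour-bound : ℕ → ∀ {m} → RootedTree m → ℕ
colour-bound t = growth-bound t 1 1 _*_

orient-bound : ℕ → ∀ {m} → RootedTree m → ℕ
orient-bound t = growth-bound t 1 1 (λ m M → m * (m * M))

module _ (G : Graph) where
  open Graph G using (_~?_; ~-sym; ~-irrefl)

  record TreeIn {m : ℕ} (T : RootedTree m) (S : List (V G)) : Set where
    field
      place     : Fin (suc m) → V G
      place∈    : ∀ i → place i ∈ S
      place-inj : ∀ {i j} → place i ≡ place j → i ≡ j
      adj⁺      : ∀ i j → TreeAdj T i j → G ⊢ place i ~ place j
      adj⁻      : ∀ i j → G ⊢ place i ~ place j → TreeAdj T i j

  treeIn-⊆ : ∀ {m} {T : RootedTree m} {S S′} → S′ ⊆ S → TreeIn T S′ → TreeIn T S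
  treeIn-⊆ S′⊆S C = record { TreeIn C ; place∈ = S′⊆S ∘ TreeIn.place∈ C }

  treeIn-root : ∀ {v S} → v ∈ S → TreeIn root S
  treeIn-root {v} v∈S = record
    { place = const v ; place∈ = const v∈S ; place-inj = λ { {zero} {zero} _ → refl }
    ; adj⁺ = λ _ _ () ; adj⁻ = λ { zero zero v~v → ~-irrefl v~v } }

  -- A placed vertex other than the spot either has no neighbour in `N` or is not heavy, and then it
  -- has at most `τ` neighbours there. So `pick` finds a leaf whose only neighbour in the copy is
  -- the spot.
  treeIn-attach : ∀ {m} {T : RootedTree m} {S S″ R N τ} (C : TreeIn T S″) p → S″ ⊆ S →
    N ⊆ S → Unique N → (∀ {u} → u ∈ N → G ⊢ TreeIn.place C p ~ u) →
    (∀ {w} → w ∉ R → length (filter (w ~?_) N) ≤ τ) →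
    (∀ {u x} → u ∈ S″ → u ≢ TreeIn.place C p → x ∈ N → G ⊢ u ~ x → u ∉ R) →
    suc (m + m) * (τ + 1) < length N → TreeIn (grow T p) S
  treeIn-attach {m} {T} {S} {S″} {R} {N} {τ} C p S″⊆S N⊆S uN H light indep long
    with u , u∈N , ¬W , u∉ ← pick _~?_ (_∷ []) (λ _ → ≤-refl) (TreeIn.place C p) (tabulate (TreeIn.place C)) N uN
      (λ {w} w∈ w≢v → length-filter-≤ (w ~?_) N λ x∈ w~x → light
        (indep (let i , eq = ∈-tabulate⁻ {f = TreeIn.place C} w∈ in subst (_∈ _) (sym eq) (TreeIn.place∈ C i)) w≢v x∈ w~x))
      -- Only the `suc m` placed vertices have to be avoided here; the common constant also leaves
      -- room for `m` subdivision vertices.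
      (≤-<-trans (*-monoˡ-≤ (τ + 1) (≤-trans (≤-reflexive (length-tabulate (TreeIn.place C))) (s≤s (m≤m+n m m)))) long) =
    record
    { place = place′
    ; place∈ = λ { zero → N⊆S u∈N ; (suc i) → S″⊆S (place∈ i) }
    ; place-inj = λ { {zero} {zero} _ → refl
                    ; {zero} {suc j} eq → contradiction eq (u≢ j)
                    ; {suc i} {zero} eq → contradiction (sym eq) (u≢ i)
                    ; {suc i} {suc j} eq → cong suc (place-inj eq) }
    ; adj⁺ = λ { zero (suc j) refl → ~-sym (H u∈N) ; (suc i) zero refl → H u∈N
               ; (suc i) (suc j) → adj⁺ i j }
    ; adj⁻ = λ { zero zero r → ~-irrefl r ; zero (suc j) r → only j (~-sym r)
               ; (suc i) zero r → only i r ; (suc i) (suc j) → adj⁻ i j } }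
    where
    open TreeIn C
    place′ : Fin (suc (suc m)) → V G
    place′ zero = u
    place′ (suc i) = place i
    u≢ : ∀ i → u ≢ place i
    u≢ i eq = u∉ (∈-tabulate⁺ {f = place} i) (here eq)
    only : ∀ i → G ⊢ place i ~ u → i ≡ p
    only i r with i Fin.≟ p
    ... | yes i≡p = i≡p
    ... | no  i≢p = contradiction r (¬W (∈-tabulate⁺ {f = place} i) (i≢p ∘ place-inj))

  all : List (V G)
  all = allFin (order G)

  ∈-all : ∀ {v} → v ∈ all
  ∈-all {v} = ∈-allFin v

  -- `O v` lists the out-neighbours of `v`. It may contain other vertices as well, and an edge may
  -- be listed at both ends.
  Orientable : ℕ → List (V G) → Set
  Orientable M S = Σ[ O ∈ (V G → List (V G)) ] (∀ v → length (O v) ≤ M)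
    × (∀ {u v} → u ∈ S → v ∈ S → G ⊢ u ~ v → u ∈ O v ⊎ v ∈ O u)

  -- All edges from `v` into `S` are directed away from `v`.
  orientable-add : ∀ {M S v} → v ∈ S → degree _~?_ S v < M → Orientable M (S ∖ v) → Orientable M S
  orientable-add {M} {S} {v} v∈S low (O , short , good) = O′ , short′ , good′
    where
    O′ : V G → List (V G)
    O′ u with u Fin.≟ v
    ... | yes _ = filter (v ~?_) S
    ... | no  _ = O u
    short′ : ∀ u → length (O′ u) ≤ M
    short′ u with u Fin.≟ v
    ... | yes _ = <⇒≤ low
    ... | no  _ = short u
    good′ : ∀ {u w} → u ∈ S → w ∈ S → G ⊢ u ~ w → u ∈ O′ w ⊎ w ∈ O′ u
    good′ {u} {w} u∈ w∈ r with u Fin.≟ v | w Fin.≟ v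
    ... | yes refl | yes refl = contradiction r ~-irrefl
    ... | yes refl | no _ = inj₂ (∈-filter⁺ _ w∈ r)
    ... | no _ | yes refl = inj₁ (∈-filter⁺ _ u∈ (~-sym r))
    ... | no u≢v | no w≢v = good (∈-∖⁺ u∈ u≢v) (∈-∖⁺ w∈ w≢v) r

  module _ (side : V G → Bool) where

    Bipartitioned : List (V G) → Set
    Bipartitioned S = ∀ {u v} → u ∈ S → v ∈ S → G ⊢ u ~ v → side u ≢ side v

    -- A class prescribes one colour on each side, which gives `m * m` classes. Every edge joins the
    -- two sides and so lies in the class given by the colours of its ends; the out-lists of all
    -- classes are concatenated.
    orientable-split : ∀ {X : Set} {m M S} → Bipartitioned S → (c : V G → Fin m) →
      (∀ S″ → S″ ⊆ S → (Unique S → Unique S″) →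
        (∀ {u v} → u ∈ S″ → v ∈ S″ → side u ≡ side v → c u ≡ c v) → X ⊎ Orientable M S″) →
      X ⊎ Orientable (m * (m * M)) S
    orientable-split {X} {m} {M} {S} bip c solve
      with ⊎-∀Fin {X = X} (λ i → ⊎-∀Fin (λ j → solve (class i j)
        (proj₁ ∘ ∈-filter⁻ _) (Unique.filter⁺ _) λ {u} {v} u∈ v∈ eq →
          trans (col u∈) (trans (cong (λ b → if b then i else j) eq) (sym (col v∈)))))
      where
      class : Fin m → Fin m → List (V G)
      class i j = filter (λ u → c u Fin.≟ (if side u then i else j)) S
      col : ∀ {i j u} → u ∈ class i j → c u ≡ (if side u then i else j)
      col u∈ = proj₂ (∈-filter⁻ _ {xs = S} u∈)
    ... | inj₁ x = inj₁ x
    ... | inj₂ q = inj₂ (O , short , good)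
      where
      row : Fin m → V G → List (V G)
      row i v = concatMap (λ j → proj₁ (q i j) v) (allFin m)
      O : V G → List (V G)
      O v = concatMap (λ i → row i v) (allFin m)
      length-allFin≤ : ∀ k → length (allFin m) * k ≤ m * k
      length-allFin≤ k = ≤-reflexive (cong (_* k) (length-tabulate {n = m} id))
      short : ∀ v → length (O v) ≤ m * (m * M)
      short v = ≤-trans (length-concatMap (λ i → row i v) (λ i → ≤-trans
          (length-concatMap (λ j → proj₁ (q i j) v) (λ j → proj₁ (proj₂ (q i j)) v) (allFin m)) (length-allFin≤ M))
        (allFin m)) (length-allFin≤ (m * M))
      include : ∀ i j {u v} → u ∈ proj₁ (q i j) v → u ∈ O v
      include i j {u} {v} u∈ = ∈-concatMap (λ i → row i v) (∈-allFin i)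
        (∈-concatMap (λ j → proj₁ (q i j) v) (∈-allFin j) u∈)
      merge : ∀ i j {u v} → u ∈ proj₁ (q i j) v ⊎ v ∈ proj₁ (q i j) u → u ∈ O v ⊎ v ∈ O u
      merge i j (inj₁ u∈) = inj₁ (include i j u∈)
      merge i j (inj₂ v∈) = inj₂ (include i j v∈)
      good : ∀ {u v} → u ∈ S → v ∈ S → G ⊢ u ~ v → u ∈ O v ⊎ v ∈ O u
      good {u} {v} u∈ v∈ r with side u in eqᵤ | side v in eqᵥ | bip u∈ v∈ r
      ... | true | true | ne = contradiction refl ne
      ... | false | false | ne = contradiction refl ne
      ... | true | false | _ = merge (c u) (c v) (proj₂ (proj₂ (q (c u) (c v)))
        (∈-filter⁺ _ u∈ (cong (λ b → if b then c u else c v) (sym eqᵤ)))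
        (∈-filter⁺ _ v∈ (cong (λ b → if b then c u else c v) (sym eqᵥ))) r)
      ... | false | true | _ = merge (c v) (c u) (proj₂ (proj₂ (q (c v) (c u)))
        (∈-filter⁺ _ u∈ (cong (λ b → if b then c v else c u) (sym eqᵤ)))
        (∈-filter⁺ _ v∈ (cong (λ b → if b then c v else c u) (sym eqᵥ))) r)

  module _ {t : ℕ} (free : Biclique-free (G ⊢_~_) t) where

    colouring-system : GrowthSystem (order G) t 1 1 _*_
    colouring-system = record
      { H = G ⊢_~_ ; H? = _~?_ ; W = λ _ → G ⊢_~_ ; W? = λ _ → _~?_ ; W-free = λ _ → free
      ; hull = _∷ [] ; hull-length = λ _ → ≤-refl
      ; Ok = λ _ → ⊤ ; Ok-⊆ = λ _ _ → tt ; Link = λ _ _ → ⊤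
      ; Q = Colorable (G ⊢_~_)
      ; Q-empty = colorable-empty
      ; Q-mono = colorable-mono
      ; Q-add = colorable-add _~?_ ~-sym λ { refl → ~-irrefl }
      ; Q-split = λ _ c solve → colorable-split c λ S″ S″⊆ u same → solve S″ S″⊆ u λ u∈ v∈ _ → same u∈ v∈
      ; Conf = TreeIn ; Conf-⊆ = treeIn-⊆ ; Conf-root = treeIn-root
      ; spot = TreeIn.place ; spot∈ = TreeIn.place∈
      ; attach = λ C p _ S″⊆S N⊆S uN H light indep long → treeIn-attach C p S″⊆S N⊆S uN H light
          (λ u∈ u≢ _ _ u∈R → indep u∈ u≢ tt (∈-concatMap (_∷ []) u∈R (here refl))) long }

    orientation-system : (V G → Bool) → GrowthSystem (order G) t 1 1 (λ m M → m * (m * M))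
    orientation-system side = record
      { H = G ⊢_~_ ; H? = _~?_ ; W = λ _ → G ⊢_~_ ; W? = λ _ → _~?_ ; W-free = λ _ → free
      ; hull = _∷ [] ; hull-length = λ _ → ≤-refl
      ; Ok = Bipartitioned side ; Ok-⊆ = λ S′⊆S bip u∈ v∈ → bip (S′⊆S u∈) (S′⊆S v∈)
      ; Link = λ u v → side u ≡ side v
      ; Q = Orientable
      ; Q-empty = (λ _ → []) , (λ _ → z≤n) , λ ()
      ; Q-mono = λ M≤M′ (O , short , good) → O , (λ v → ≤-trans (short v) M≤M′) , good
      ; Q-add = orientable-add
      ; Q-split = orientable-split side
      ; Conf = TreeIn ; Conf-⊆ = treeIn-⊆ ; Conf-root = treeIn-root
      ; spot = TreeIn.place ; spot∈ = TreeIn.place∈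
      -- A placed vertex adjacent to some `x` in `N` has the neighbour `x` in common with the spot,
      -- so the two are on the same side and hence linked.
      ; attach = λ C p bip S″⊆S N⊆S uN H light indep long → treeIn-attach C p S″⊆S N⊆S uN H light
          (λ u∈ u≢ x∈ u~x u∈R → indep u∈ u≢
            (same-side (bip (S″⊆S u∈) (N⊆S x∈) u~x) (bip (S″⊆S (TreeIn.place∈ C p)) (N⊆S x∈) (H x∈)))
            (∈-concatMap (_∷ []) u∈R (here refl))) long }

-- Subdivided trees, siblings and the assembly of the colouring

Incident : ∀ {m} → RootedTree m → Fin (suc m) → Fin m → Set
Incident (grow T p) zero    zero    = ⊤
Incident (grow T p) (suc i) zero    = i ≡ p
Incident (grow T p) zero    (suc e) = ⊥
Incident (grow T p) (suc i) (suc e) = Incident T i e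

record SubdivisionIn (G : Graph) {m : ℕ} (T : RootedTree m) : Set where
  field
    vert      : Fin (suc m) → V G
    edge      : Fin m → V G
    vert-inj  : ∀ {i j} → vert i ≡ vert j → i ≡ j
    edge-inj  : ∀ {e f} → edge e ≡ edge f → e ≡ f
    vert≢edge : ∀ {i e} → vert i ≢ edge e
    vert-vert : ∀ i j → ¬ (G ⊢ vert i ~ vert j)
    edge-edge : ∀ e f → ¬ (G ⊢ edge e ~ edge f)
    inc⁺      : ∀ i e → Incident T i e → G ⊢ vert i ~ edge e
    inc⁻      : ∀ i e → G ⊢ vert i ~ edge e → Incident T i e

doubled : ℕ → ℕ
doubled zero    = zero
doubled (suc m) = suc (suc (doubled m))

old : ∀ {m} → Fin (suc m) → Fin (suc (doubled m))
old {zero}  zero    = zero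
old {suc m} zero    = zero
old {suc m} (suc i) = suc (suc (old i))

middle : ∀ {m} → Fin m → Fin (suc (doubled m))
middle zero    = suc zero
middle (suc e) = suc (suc (middle e))

-- The subdivision vertex is attached first, as number 0; it becomes number 1 when the new vertex is
-- attached to it. This explains `old` and `middle`.
subdivide : ∀ {m} → RootedTree m → RootedTree (doubled m)
subdivide root       = root
subdivide (grow T p) = grow (grow (subdivide T) (old p)) zero

old-inj : ∀ {m} {i j : Fin (suc m)} → old i ≡ old j → i ≡ j
old-inj {zero}  {zero}  {zero}  _  = refl
old-inj {suc m} {zero}  {zero}  _  = refl
old-inj {suc m} {suc i} {suc j} eq = cong suc (old-inj (Fin.suc-injective (Fin.suc-injective eq)))

middle-inj : ∀ {m} {e f : Fin m} → middle e ≡ middle f → e ≡ f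
middle-inj {e = zero}  {zero}  _  = refl
middle-inj {e = suc e} {suc f} eq = cong suc (middle-inj (Fin.suc-injective (Fin.suc-injective eq)))

old≢middle : ∀ {m} {i : Fin (suc m)} {e : Fin m} → old i ≢ middle e
old≢middle {suc m} {zero}  {zero}  ()
old≢middle {suc m} {zero}  {suc e} ()
old≢middle {suc m} {suc i} {zero}  ()
old≢middle {suc m} {suc i} {suc e} eq = old≢middle (Fin.suc-injective (Fin.suc-injective eq))

subdivide-old : ∀ {m} (T : RootedTree m) i j → ¬ TreeAdj (subdivide T) (old i) (old j)
subdivide-old (grow T p) zero    zero    ()
subdivide-old (grow T p) zero    (suc j) ()
subdivide-old (grow T p) (suc i) zero    ()
subdivide-old (grow T p) (suc i) (suc j) r = subdivide-old T i j r

subdivide-middle : ∀ {m} (T : RootedTree m) e f → ¬ TreeAdj (subdivide T) (middle e) (middle f)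
subdivide-middle (grow T p) zero    (suc f) eq = old≢middle (sym eq)
subdivide-middle (grow T p) (suc e) zero    eq = old≢middle (sym eq)
subdivide-middle (grow T p) (suc e) (suc f) r  = subdivide-middle T e f r

subdivide⁺ : ∀ {m} (T : RootedTree m) i e → Incident T i e → TreeAdj (subdivide T) (old i) (middle e)
subdivide⁺ (grow T p) zero    zero    _    = refl
subdivide⁺ (grow T p) (suc i) zero    refl = refl
subdivide⁺ (grow T p) (suc i) (suc e) r    = subdivide⁺ T i e r

subdivide⁻ : ∀ {m} (T : RootedTree m) i e → TreeAdj (subdivide T) (old i) (middle e) → Incident T i e
subdivide⁻ (grow T p) zero    zero    _  = tt
subdivide⁻ (grow T p) (suc i) zero    eq = old-inj eq
subdivide⁻ (grow T p) (suc i) (suc e) r  = subdivide⁻ T i e r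

treeIn⇒subdivisionIn : ∀ {G m S} {T : RootedTree m} → TreeIn G (subdivide T) S → SubdivisionIn G T
treeIn⇒subdivisionIn {T = T} C = record
  { vert = place ∘ old ; edge = place ∘ middle
  ; vert-inj = old-inj ∘ place-inj ; edge-inj = middle-inj ∘ place-inj
  ; vert≢edge = old≢middle ∘ place-inj
  ; vert-vert = λ i j → subdivide-old T i j ∘ adj⁻ _ _
  ; edge-edge = λ e f → subdivide-middle T e f ∘ adj⁻ _ _
  ; inc⁺ = λ i e → adj⁺ _ _ ∘ subdivide⁺ T i e
  ; inc⁻ = λ i e → subdivide⁻ T i e ∘ adj⁻ _ _ }
  where open TreeIn C

-- At most `d + d` vertices block a given vertex, the hull of `w` is `w ∷ O w`, and a new leaf has
-- to avoid `w ∷ O w ++ OO w`.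
pair-bound : ℕ → ∀ {m} → RootedTree m → ℕ
pair-bound d = growth-bound (suc (d + d)) (suc d) (suc (d + d * d)) _*_

module _ (G : Graph) {k d : ℕ} (c : V G → Fin k) (proper : IsProperColoring G c)
  (O : V G → List (V G)) (short : ∀ v → length (O v) ≤ d)
  (O-adj : ∀ {u v} → u ∈ O v → G ⊢ u ~ v)
  (cover : ∀ {u v} → G ⊢ u ~ v → u ∈ O v ⊎ v ∈ O u) where
  open Graph G using (~-sym; ~-irrefl)

  OO : V G → List (V G)
  OO v = concatMap O (O v)

  OO-length : ∀ v → length (OO v) ≤ d * d
  OO-length v = ≤-trans (length-concatMap O short (O v)) (*-monoˡ-≤ d (short v))

  Common : V G → Rel (V G) 0ℓ
  Common v u x = v ∈ O x × u ∈ O x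

  Siblings : Rel (V G) 0ℓ
  Siblings v u = v ≢ u × c v ≡ c u × ∃ (Common v u)

  common? : ∀ v u → Dec (∃ (Common v u))
  common? v u = Fin.any? (λ x → (v ∈? O x) ×-dec (u ∈? O x))

  siblings? : B.Decidable Siblings
  siblings? v u = ¬? (v Fin.≟ u) ×-dec (c v Fin.≟ c u) ×-dec common? v u

  between : V G → V G → V G
  between v u with common? v u
  ... | yes (x , _) = x
  -- A default value; siblings fall under the other case.
  ... | no  _       = v

  between-common : ∀ {v u} → Siblings v u → Common v u (between v u)
  between-common {v} {u} (_ , _ , p) with common? v u
  ... | yes (_ , q) = q
  ... | no ¬p = contradiction p ¬p

  Blocks : V G → Rel (V G) 0ℓ
  Blocks v w u = w ∈ O u ++ O (between v u)

  -- One element of `M` suffices: what blocks it is an out-neighbour of it or of the vertex between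
  -- it and `v`.
  blocks-free : ∀ v → Biclique-free (Blocks v) (suc (d + d))
  blocks-free v R (x ∷ M) uR _ long _ rel = contradiction
    (≤-trans (⊆⇒length≤ uR λ w∈ → rel w∈ (here refl))
      (≤-trans (≤-reflexive (length-++ (O x))) (+-mono-≤ (short x) (short _))))
    (<⇒≱ long)

  -- By `ends`, each subdivision vertex has both its ends as out-neighbours, which places them in
  -- its hull.
  record PairConf {m : ℕ} (T : RootedTree m) (S : List (V G)) : Set where
    field
      sub   : SubdivisionIn G T
    open SubdivisionIn sub public
    field
      vert∈ : ∀ i → vert i ∈ S
      ends  : ∀ e → ∃[ i ] ∃[ j ] i ≢ j × vert i ∈ O (edge e) × vert j ∈ O (edge e)

  pairConf-root : ∀ {v S} → v ∈ S → PairConf root S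
  pairConf-root {v} v∈ = record
    { sub = record
      { vert = const v ; edge = λ () ; vert-inj = λ { {zero} {zero} _ → refl } ; edge-inj = λ { {()} }
      ; vert≢edge = λ { {e = ()} } ; vert-vert = λ _ _ → ~-irrefl ; edge-edge = λ ()
      ; inc⁺ = λ _ () ; inc⁻ = λ _ () }
    ; vert∈ = const v∈ ; ends = λ () }

  -- A subdivision vertex w has two ends, both in the hull of w, and at most one of them is the
  -- vertex at which u is attached. Hence w is not heavy for the latter.
  pairConf-attach : ∀ {m} {T : RootedTree m} {S S″ R N τ} (C : PairConf T S″) p → S″ ⊆ S →
    N ⊆ S → Unique N → (∀ {u} → u ∈ N → Siblings (PairConf.vert C p) u) →
    (∀ {w} → w ∉ R → length (filter (λ u → w ∈? O u ++ O (between (PairConf.vert C p) u)) N) ≤ τ) →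
    (∀ {u} → u ∈ S″ → u ≢ PairConf.vert C p → u ∉ concatMap (λ w → w ∷ O w) R) →
    suc (m + m) * (τ + suc (d + d * d)) < length N → PairConf (grow T p) S
  pairConf-attach {m} {T} {S} {S″} {R} {N} {τ} C p S″⊆S N⊆S uN H light indep long
    with u , u∈N , ¬W , u∉ ← pick (λ w u → w ∈? O u ++ O (between (PairConf.vert C p) u))
      -- Avoiding this list keeps `u` different from `w` and outside `O w`. As `u` is an
      -- out-neighbour of `x`, it also keeps `x` different from `w` and outside `O w`. Together with
      -- `¬W`, which excludes the reverse arcs, neither is adjacent to `w` unless `w` is the spot.
      (λ w → w ∷ O w ++ OO w)
      (λ w → s≤s (≤-trans (≤-reflexive (length-++ (O w))) (+-mono-≤ (short w) (OO-length w))))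
      (PairConf.vert C p) (tabulate (PairConf.vert C) ++ tabulate (PairConf.edge C)) N uN
      (λ {w} w∈ w≢v → light λ w∈R → case ∈-++⁻ (tabulate (PairConf.vert C)) w∈ of λ
        { (inj₁ w∈) → let i , eq = ∈-tabulate⁻ {f = PairConf.vert C} w∈ in
            indep (subst (_∈ _) (sym eq) (PairConf.vert∈ C i)) w≢v (∈-concatMap _ w∈R (here refl))
        ; (inj₂ w∈) → let e , eq = ∈-tabulate⁻ {f = PairConf.edge C} w∈
                          i , j , i≢j , i∈ , j∈ = PairConf.ends C e
                          in case i Fin.≟ p of λ
                          { (yes refl) → indep (PairConf.vert∈ C j) (λ eq′ → i≢j (sym (PairConf.vert-inj C eq′)))
                              (∈-concatMap _ w∈R (there (subst (λ w → PairConf.vert C j ∈ O w) (sym eq) j∈)))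
                          ; (no i≢p) → indep (PairConf.vert∈ C i) (i≢p ∘ PairConf.vert-inj C)
                              (∈-concatMap _ w∈R (there (subst (λ w → PairConf.vert C i ∈ O w) (sym eq) i∈))) } })
      (subst (λ l → l * (τ + suc (d + d * d)) < length N) (sym (trans (length-++ (tabulate (PairConf.vert C)))
        (cong₂ _+_ (length-tabulate (PairConf.vert C)) (length-tabulate (PairConf.edge C))))) long) =
    record
    { sub = record
      { vert = vert′ ; edge = edge′
      ; vert-inj = λ { {zero} {zero} _ → refl
                     ; {zero} {suc j} eq → contradiction eq (u≢ (vert∈ws j))
                     ; {suc i} {zero} eq → contradiction (sym eq) (u≢ (vert∈ws i))
                     ; {suc i} {suc j} eq → cong suc (vert-inj eq) }
      ; edge-inj = λ { {zero} {zero} _ → refl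
                     ; {zero} {suc f} eq → contradiction eq (x≢ (edge∈ws f))
                     ; {suc e} {zero} eq → contradiction (sym eq) (x≢ (edge∈ws e))
                     ; {suc e} {suc f} eq → cong suc (edge-inj eq) }
      ; vert≢edge = λ { {zero} {zero} u≡x → ~-irrefl (O-adj (subst (λ x → u ∈ O x) (sym u≡x) u∈Ox))
                      ; {zero} {suc e} → u≢ (edge∈ws e)
                      ; {suc i} {zero} eq → x≢ (vert∈ws i) (sym eq)
                      ; {suc i} {suc e} → vert≢edge }
      ; vert-vert = λ { zero zero → ~-irrefl
                      ; zero (suc j) → u≁vert j
                      ; (suc i) zero → u≁vert i ∘ ~-sym
                      ; (suc i) (suc j) → vert-vert i j }
      ; edge-edge = λ { zero zero → ~-irrefl
                      ; zero (suc f) → x≁edge f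
                      ; (suc e) zero → x≁edge e ∘ ~-sym
                      ; (suc e) (suc f) → edge-edge e f }
      ; inc⁺ = λ { zero zero _ → O-adj u∈Ox
                 ; (suc i) zero refl → O-adj v∈Ox
                 ; (suc i) (suc e) → inc⁺ i e }
      ; inc⁻ = λ { zero zero _ → tt
                 ; zero (suc e) r → u≁ (edge∈ws e) (vert≢edge ∘ sym) r
                 ; (suc i) zero r → only i r
                 ; (suc i) (suc e) → inc⁻ i e } }
    ; vert∈ = λ { zero → N⊆S u∈N ; (suc i) → S″⊆S (vert∈ i) }
    ; ends = λ { zero → zero , suc p , (λ ()) , u∈Ox , v∈Ox
               ; (suc e) → let i , j , i≢j , i∈ , j∈ = ends e in
                   suc i , suc j , i≢j ∘ Fin.suc-injective , i∈ , j∈ } }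
    where
    open PairConf C
    v = vert p
    x = between v u
    ws = tabulate vert ++ tabulate edge
    v∈Ox : v ∈ O x
    v∈Ox = proj₁ (between-common (H u∈N))
    u∈Ox : u ∈ O x
    u∈Ox = proj₂ (between-common (H u∈N))
    vert′ : Fin (suc (suc m)) → V G
    vert′ zero = u
    vert′ (suc i) = vert i
    edge′ : Fin (suc m) → V G
    edge′ zero = x
    edge′ (suc e) = edge e
    vert∈ws : ∀ i → vert i ∈ ws
    vert∈ws i = ∈-++⁺ˡ (∈-tabulate⁺ {f = vert} i)
    edge∈ws : ∀ e → edge e ∈ ws
    edge∈ws e = ∈-++⁺ʳ (tabulate vert) (∈-tabulate⁺ {f = edge} e)
    u≢ : ∀ {w} → w ∈ ws → u ≢ w
    u≢ w∈ eq = u∉ w∈ (here eq)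
    u∉O : ∀ {w} → w ∈ ws → u ∉ O w
    u∉O w∈ u∈ = u∉ w∈ (there (∈-++⁺ˡ u∈))
    x∉O : ∀ {w} → w ∈ ws → x ∉ O w
    x∉O {w} w∈ x∈ = u∉ w∈ (there (∈-++⁺ʳ (O w) (∈-concatMap O x∈ u∈Ox)))
    x≢ : ∀ {w} → w ∈ ws → x ≢ w
    x≢ w∈ eq = u∉O w∈ (subst (λ y → u ∈ O y) eq u∈Ox)
    u≁ : ∀ {w} → w ∈ ws → w ≢ v → ¬ (G ⊢ u ~ w)
    u≁ w∈ w≢v r with cover r
    ... | inj₁ u∈ = u∉O w∈ u∈
    ... | inj₂ w∈u = ¬W w∈ w≢v (∈-++⁺ˡ w∈u)
    x≁ : ∀ {w} → w ∈ ws → w ≢ v → ¬ (G ⊢ x ~ w)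
    x≁ w∈ w≢v r with cover r
    ... | inj₁ x∈ = x∉O w∈ x∈
    ... | inj₂ w∈x = ¬W w∈ w≢v (∈-++⁺ʳ (O u) w∈x)
    u≁vert : ∀ i → ¬ (G ⊢ u ~ vert i)
    u≁vert i with i Fin.≟ p
    -- The spot is exempt from `¬W`; here it helps that siblings have the same colour.
    ... | yes refl = λ r → proper r (sym (proj₁ (proj₂ (H u∈N))))
    ... | no i≢p = u≁ (vert∈ws i) (i≢p ∘ vert-inj)
    x≁edge : ∀ e → ¬ (G ⊢ x ~ edge e)
    x≁edge e = x≁ (edge∈ws e) (vert≢edge ∘ sym)
    only : ∀ i → G ⊢ vert i ~ x → i ≡ p
    only i r with i Fin.≟ p
    ... | yes i≡p = i≡p
    ... | no  i≢p = contradiction (~-sym r) (x≁ (vert∈ws i) (i≢p ∘ vert-inj))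

  sibling-system : GrowthSystem (order G) (suc (d + d)) (suc d) (suc (d + d * d)) _*_
  sibling-system = record
    { H = Siblings ; H? = siblings? ; W = Blocks ; W? = λ v w u → w ∈? O u ++ O (between v u) ; W-free = blocks-free
    ; hull = λ w → w ∷ O w ; hull-length = λ w → s≤s (short w)
    ; Ok = λ _ → ⊤ ; Ok-⊆ = λ _ _ → tt ; Link = λ _ _ → ⊤
    ; Q = Colorable Siblings
    ; Q-empty = colorable-empty
    ; Q-mono = colorable-mono
    ; Q-add = colorable-add siblings? (λ (u≢v , eq , x , p , q) → u≢v ∘ sym , sym eq , x , q , p)
        (λ eq (u≢v , _) → u≢v eq)
    ; Q-split = λ _ c solve → colorable-split c λ S″ S″⊆ u same → solve S″ S″⊆ u λ u∈ v∈ _ → same u∈ v∈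
    ; Conf = PairConf
    ; Conf-⊆ = λ S′⊆S C → record { PairConf C ; vert∈ = S′⊆S ∘ PairConf.vert∈ C }
    ; Conf-root = pairConf-root
    ; spot = PairConf.vert ; spot∈ = PairConf.vert∈
    ; attach = λ C p _ S″⊆S N⊆S uN H light indep long → pairConf-attach C p S″⊆S N⊆S uN H light
        (λ u∈ u≢ → indep u∈ u≢ tt) long }

-- Star colouring in terms of paths: a two-coloured walk of three edges turns back. Unlike
-- `IsStarColoring` this does not mention components.
IsGood : (G : Graph) {k : ℕ} → (V G → Fin k) → Set
IsGood G c = IsProperColoring G c
  × (∀ {u v w x} → G ⊢ u ~ v → G ⊢ v ~ w → G ⊢ w ~ x → c u ≡ c w → c v ≡ c x → u ≡ w ⊎ v ≡ x)

GoodColorable : Graph → ℕ → Set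
GoodColorable G k = Σ[ c ∈ (V G → Fin k) ] IsGood G c

-- The square of the graph is coloured: vertices at distance one or two get different colours, so
-- already `u` and `w` coincide.
bounded-degree-coloring : ∀ G {D} (N : V G → List (V G)) → (∀ v → length (N v) ≤ D) →
  (∀ {u v} → G ⊢ u ~ v → u ∈ N v) → GoodColorable G (suc (D + D * D) * suc (D + D * D))
bounded-degree-coloring G {D} N short nbr
  with c , good ← digraph-coloring (λ v → N v ++ concatMap N (N v))
    (λ v → ≤-trans (≤-reflexive (length-++ (N v)))
      (+-mono-≤ (short v) (≤-trans (length-concatMap N short (N v)) (*-monoˡ-≤ D (short v))))) =
  c , (λ {u} {v} r → good (∈-++⁺ˡ (nbr r)) λ { refl → ~-irrefl r }) , path
  where
  open Graph G using (~-irrefl)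
  path : ∀ {u v w x} → G ⊢ u ~ v → G ⊢ v ~ w → G ⊢ w ~ x → c u ≡ c w → c v ≡ c x → u ≡ w ⊎ v ≡ x
  path {u} {v} {w} uv vw _ eq _ with u Fin.≟ w
  ... | yes u≡w = inj₁ u≡w
  ... | no  u≢w = contradiction eq (good (∈-++⁺ʳ (N w) (∈-concatMap N (nbr vw) (nbr uv))) u≢w)

-- In a two-coloured path u v w x both u and w are in-neighbours of v, since two out-neighbours
-- of a vertex are siblings and directed paths have ends of different colours; the same
-- argument for v w x then fails.
sibling-coloring : ∀ G {k d h} (c : V G → Fin k) (proper : IsProperColoring G c) (O : V G → List (V G))
  (short : ∀ v → length (O v) ≤ d) (O-adj : ∀ {u v} → u ∈ O v → G ⊢ u ~ v)
  (cover : ∀ {u v} → G ⊢ u ~ v → u ∈ O v ⊎ v ∈ O u) →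
  Colorable (Siblings G c proper O short O-adj cover) h (all G) →
  GoodColorable G (k * (h * (suc (d * d) * suc (d * d))))
sibling-coloring G {k} {d} {h} c proper O short O-adj cover (s , s-good)
  with g , g-good ← digraph-coloring (OO G c proper O short O-adj cover) (OO-length G c proper O short O-adj cover) =
  col , (λ r eq → proper r (col-c eq)) , path
  where
  col : V G → Fin (k * (h * (suc (d * d) * suc (d * d))))
  col v = combine (c v) (combine (s v) (g v))
  col-c : ∀ {u v} → col u ≡ col v → c u ≡ c v
  col-c {u} {v} = Fin.combine-injectiveˡ (c u) _ (c v) _
  col-s : ∀ {u v} → col u ≡ col v → s u ≡ s v
  col-s {u} {v} eq = Fin.combine-injectiveˡ (s u) (g u) (s v) (g v) (Fin.combine-injectiveʳ (c u) _ (c v) _ eq)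
  col-g : ∀ {u v} → col u ≡ col v → g u ≡ g v
  col-g {u} {v} eq = Fin.combine-injectiveʳ (s u) (g u) (s v) (g v) (Fin.combine-injectiveʳ (c u) _ (c v) _ eq)
  in-neighbours : ∀ {u v w} → G ⊢ u ~ v → G ⊢ v ~ w → col u ≡ col w → u ≢ w → v ∈ O u × v ∈ O w
  in-neighbours {u} {v} {w} uv vw eq u≢w with cover uv | cover vw
  ... | inj₁ u∈v | inj₁ v∈w = contradiction (col-g eq) (g-good (∈-concatMap O v∈w u∈v) u≢w)
  ... | inj₁ u∈v | inj₂ w∈v = contradiction (col-s eq) (s-good (∈-all G) (∈-all G) (u≢w , col-c eq , v , u∈v , w∈v))
  ... | inj₂ v∈u | inj₁ v∈w = v∈u , v∈w
  ... | inj₂ v∈u | inj₂ w∈v = contradiction (sym (col-g eq)) (g-good (∈-concatMap O v∈u w∈v) (u≢w ∘ sym))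
  path : ∀ {u v w x} → G ⊢ u ~ v → G ⊢ v ~ w → G ⊢ w ~ x → col u ≡ col w → col v ≡ col x → u ≡ w ⊎ v ≡ x
  path {u} {v} {w} {x} uv vw wx eq eq′ with u Fin.≟ w | v Fin.≟ x
  ... | yes u≡w | _ = inj₁ u≡w
  ... | no _ | yes v≡x = inj₂ v≡x
  ... | no u≢w | no v≢x =
    -- The path from `x` through `w` to `v` is directed, and its ends would agree under `g`.
    contradiction (col-g eq′) (g-good (∈-concatMap O w∈x v∈w) v≢x)
    where
    v∈w = proj₂ (in-neighbours uv vw eq u≢w)
    w∈x = proj₂ (in-neighbours vw wx eq′ v≢x)

-- The factors count the colours `c`, `s` and `g` of `sibling-coloring`; `d` adds up the
-- orientations of all `k * k` pairs of colour classes.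
star-bound : ℕ → ∀ {m} → RootedTree m → ℕ
star-bound t T = k * (pair-bound d T * (suc (d * d) * suc (d * d)))
  where
  k = colour-bound t (subdivide T)
  d = k * (k * orient-bound t (subdivide T))

subdivisionIn-or-coloring : ∀ G {t} → Biclique-free (G ⊢_~_) t → ∀ {m} (T : RootedTree m) →
  SubdivisionIn G T ⊎ GoodColorable G (star-bound t T)
subdivisionIn-or-coloring G {t} free T
  with grows (colouring-system G free) (subdivide T) (all G) (Unique.allFin⁺ _) tt
... | inj₁ C = inj₁ (treeIn⇒subdivisionIn C)
... | inj₂ (c , c-good) with ⊎-∀Fin (λ α → ⊎-∀Fin (λ β → orient α β))
  where
  M = orient-bound t (subdivide T)
  S : Fin _ → Fin _ → List (V G)
  S α β = filter (λ v → (c v Fin.≟ α) ⊎-dec (c v Fin.≟ β)) (all G)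
  -- This includes the case that `α` and `β` are equal, where the class spans no edge.
  bip : ∀ α β → Bipartitioned G (λ v → does (c v Fin.≟ α)) (S α β)
  bip α β {u} {v} u∈ v∈ r eq with c u Fin.≟ α | c v Fin.≟ α
  ... | yes p | yes q = c-good (∈-all G) (∈-all G) r (trans p (sym q))
  ... | no p | no q with proj₂ (∈-filter⁻ _ {xs = all G} u∈) | proj₂ (∈-filter⁻ _ {xs = all G} v∈)
  ...   | inj₁ p′ | _ = p p′
  ...   | inj₂ _ | inj₁ q′ = q q′
  ...   | inj₂ p′ | inj₂ q′ = c-good (∈-all G) (∈-all G) r (trans p′ (sym q′))
  orient : ∀ α β → TreeIn G (subdivide T) (all G) ⊎ Orientable G M (S α β)
  orient α β with grows (orientation-system G free (λ v → does (c v Fin.≟ α))) (subdivide T) (S α β)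
      (Unique.filter⁺ _ (Unique.allFin⁺ _)) (bip α β)
  ... | inj₁ C = inj₁ (treeIn-⊆ G (λ _ → ∈-all G) C)
  ... | inj₂ q = inj₂ q
... | inj₁ C = inj₁ (treeIn⇒subdivisionIn C)
... | inj₂ q = finish
  where
  open Graph G using (_~?_; ~-sym)
  k = colour-bound t (subdivide T)
  M = orient-bound t (subdivide T)
  d = k * (k * M)
  length-allFin≤ : ∀ l → length (allFin k) * l ≤ k * l
  length-allFin≤ l = ≤-reflexive (cong (_* l) (length-tabulate {n = k} id))
  row : Fin k → V G → List (V G)
  row α v = concatMap (λ β → proj₁ (q α β) v) (allFin k)
  O₀ O : V G → List (V G)
  O₀ v = concatMap (λ α → row α v) (allFin k)
  -- The lists of `Orientable` may contain non-neighbours, but siblings need genuine arcs.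
  O v = filter (_~? v) (O₀ v)
  short : ∀ v → length (O v) ≤ d
  short v = ≤-trans (length-filter (_~? v) (O₀ v)) (≤-trans
    (length-concatMap (λ α → row α v) (λ α → ≤-trans
        (length-concatMap (λ β → proj₁ (q α β) v) (λ β → proj₁ (proj₂ (q α β)) v) (allFin k)) (length-allFin≤ M))
      (allFin k)) (length-allFin≤ (k * M)))
  include : ∀ α β {u v} → G ⊢ u ~ v → u ∈ proj₁ (q α β) v → u ∈ O v
  include α β {u} {v} r u∈ = ∈-filter⁺ (_~? v) (∈-concatMap (λ α → row α v) (∈-allFin α)
    (∈-concatMap (λ β → proj₁ (q α β) v) (∈-allFin β) u∈)) r
  O-adj : ∀ {u v} → u ∈ O v → G ⊢ u ~ v
  O-adj {u} {v} u∈ = proj₂ (∈-filter⁻ (_~? v) {xs = O₀ v} u∈)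
  cover : ∀ {u v} → G ⊢ u ~ v → u ∈ O v ⊎ v ∈ O u
  cover {u} {v} r with proj₂ (proj₂ (q (c u) (c v))) (∈-filter⁺ _ (∈-all G) (inj₁ refl)) (∈-filter⁺ _ (∈-all G) (inj₂ refl)) r
  ... | inj₁ u∈ = inj₁ (include (c u) (c v) r u∈)
  ... | inj₂ v∈ = inj₂ (include (c u) (c v) (~-sym r) v∈)
  proper : IsProperColoring G c
  proper = c-good (∈-all G) (∈-all G)
  finish : SubdivisionIn G T ⊎ GoodColorable G (star-bound t T)
  finish with grows (sibling-system G c proper O short O-adj cover) T (all G) (Unique.allFin⁺ _) tt
  ... | inj₁ C = inj₁ (PairConf.sub C)
  ... | inj₂ h = inj₂ (sibling-coloring G c proper O short O-adj cover h)

-- Star colourings and bicoloured paths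

subset : ∀ {n} {P : Pred (Fin n) 0ℓ} → Decidable P → Subset n
subset P? = Vec.tabulate (does ∘ P?)

module _ {n} {P : Pred (Fin n) 0ℓ} (P? : Decidable P) where

  ∈-subset⁺ : ∀ {i} → P i → i Subset.∈ subset P?
  ∈-subset⁺ {i} p = Vec.lookup⇒[]= i (subset P?) (trans (Vec.lookup∘tabulate (does ∘ P?) i) (dec-true (P? i) p))

  ∈-subset⁻ : ∀ {i} → i Subset.∈ subset P? → P i
  ∈-subset⁻ {i} i∈ with P? i | trans (sym (Vec.lookup∘tabulate (does ∘ P?) i)) (Vec.[]=⇒lookup i∈)
  ... | yes p | _ = p

-- The walk need not be a path: for a ≡ d this excludes triangles.
StarLike : Graph → Set
StarLike H = ∀ {a b c d} → H ⊢ a ~ b → H ⊢ b ~ c → H ⊢ c ~ d → a ≡ c ⊎ b ≡ d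

module _ (G : Graph) {P : Pred (V G) 0ℓ} (P? : Decidable P) where

  private
    members : List (V G)
    members = filter P? (allFin (order G))

  vertex : V (induced G P?) → V G
  vertex = lookup members

  vertex-inj : ∀ {i j} → vertex i ≡ vertex j → i ≡ j
  vertex-inj = lookup-unique (Unique.filter⁺ P? (Unique.allFin⁺ _))

  vertex-P : ∀ i → P (vertex i)
  vertex-P i = proj₂ (∈-filter⁻ P? {xs = allFin (order G)} (∈-lookup i))

  vertex-onto : ∀ {v} → P v → ∃[ i ] vertex i ≡ v
  vertex-onto {v} p = Any.index v∈ , sym (lookup-index v∈)
    where v∈ = ∈-filter⁺ P? (∈-allFin v) p

universal⇒isStar : ∀ H (z : V H) → (∀ {i} → i ≢ z → H ⊢ z ~ i) →
  (∀ {i j} → i ≢ z → j ≢ z → ¬ (H ⊢ i ~ j)) → IsStar H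
universal⇒isStar H@record{ order = suc m } z spoke indep =
  m , mk↔ₛ′ to′ from′ to∘from from∘to , λ u v → mk⇔ (adj⁺ u v) (adj⁻ u v)
  where
  open Graph H using (~-sym; ~-irrefl)
  to′ : Fin (suc m) → Fin (suc m)
  to′ i with i Fin.≟ z
  ... | yes _ = zero
  ... | no i≢z = suc (punchOut (i≢z ∘ sym))
  from′ : Fin (suc m) → Fin (suc m)
  from′ zero = z
  from′ (suc j) = punchIn z j
  to∘from : ∀ j → to′ (from′ j) ≡ j
  to∘from zero with z Fin.≟ z
  ... | yes _ = refl
  ... | no z≢z = contradiction refl z≢z
  to∘from (suc j) with punchIn z j Fin.≟ z
  ... | yes eq = contradiction eq (Fin.punchInᵢ≢i z j)
  ... | no _ = cong suc (trans (Fin.punchOut-cong z refl) (Fin.punchOut-punchIn z))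
  from∘to : ∀ i → from′ (to′ i) ≡ i
  from∘to i with i Fin.≟ z
  ... | yes eq = sym eq
  ... | no i≢z = Fin.punchIn-punchOut (i≢z ∘ sym)
  adj⁺ : ∀ u v → H ⊢ u ~ v → K 1 m ⊢ to′ u ~ to′ v
  adj⁺ u v r with u Fin.≟ z | v Fin.≟ z
  ... | yes refl | yes refl = contradiction r ~-irrefl
  ... | yes _ | no _ = tt
  ... | no _ | yes _ = tt
  ... | no u≢z | no v≢z = contradiction r (indep u≢z v≢z)
  adj⁻ : ∀ u v → K 1 m ⊢ to′ u ~ to′ v → H ⊢ u ~ v
  adj⁻ u v r with u Fin.≟ z | v Fin.≟ z
  ... | yes refl | no v≢z = spoke v≢z
  ... | no u≢z | yes refl = ~-sym (spoke u≢z)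

-- A walk from the centre never leaves the centre and its neighbours, so these form the component.
-- An edge between two neighbours would close a triangle, which `StarLike` forbids.
starLike⇒isStarForest : ∀ H → StarLike H → IsStarForest H
starLike⇒isStarForest H star C ((v , v∈C) , comp) =
  let i , eq = vertex-onto H (Subset._∈? C) z∈C in
  universal⇒isStar (induced H (Subset._∈? C)) i
    (λ {j} j≢i → subst (λ w → H ⊢ w ~ _) (sym eq) (spoke (λ p → j≢i (vertex-inj H (Subset._∈? C) (trans p (sym eq))))
      (vertex-P H (Subset._∈? C) j)))
    (λ {j} {k} j≢i k≢i → indep (λ p → j≢i (vertex-inj H (Subset._∈? C) (trans p (sym eq))))
      (λ p → k≢i (vertex-inj H (Subset._∈? C) (trans p (sym eq))))
      (vertex-P H (Subset._∈? C) j) (vertex-P H (Subset._∈? C) k))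
  where
  open Graph H using (_~?_; ~-sym)
  Branching : V H → Set
  Branching u = ∃[ p ] ∃[ q ] p ≢ q × H ⊢ u ~ p × H ⊢ u ~ q
  branching? : Decidable Branching
  branching? u = Fin.any? λ p → Fin.any? λ q → ¬? (p Fin.≟ q) ×-dec (u ~? p) ×-dec (u ~? q)
  -- A vertex with two neighbours can only be the centre; without one, every vertex of C will do.
  centre : Σ[ z ∈ V H ] z Subset.∈ C × ((∀ u → u Subset.∈ C → ¬ Branching u) ⊎ Branching z)
  centre with Fin.any? (λ u → (u Subset.∈? C) ×-dec branching? u)
  ... | yes (u , u∈C , br) = u , u∈C , inj₂ br
  ... | no none = v , v∈C , inj₁ λ u u∈C br → none (u , u∈C , br)
  z = proj₁ centre
  z∈C = proj₁ (proj₂ centre)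
  step : ∀ {w w′} → z ≡ w ⊎ H ⊢ z ~ w → w Subset.∈ C → H ⊢ w ~ w′ → z ≡ w′ ⊎ H ⊢ z ~ w′
  step (inj₁ refl) _ r = inj₂ r
  step {w} {w′} (inj₂ zw) w∈C ww′ with z Fin.≟ w′
  ... | yes z≡w′ = inj₁ z≡w′
  ... | no z≢w′ with proj₂ (proj₂ centre)
  ...   | inj₁ none = contradiction (z , w′ , z≢w′ , ~-sym zw , ww′) (none w w∈C)
  -- One of `p` and `q` differs from `w`; from it, the walk through `z` and `w` to `w′` does not
  -- turn back.
  ...   | inj₂ (p , q , p≢q , zp , zq) with star (~-sym zp) zw ww′ | star (~-sym zq) zw ww′
  ...     | inj₂ eq | _ = contradiction eq z≢w′
  ...     | inj₁ _ | inj₂ eq = contradiction eq z≢w′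
  ...     | inj₁ p≡w | inj₁ q≡w = contradiction (trans p≡w (sym q≡w)) p≢q
  walk : ∀ {w w′} → z ≡ w ⊎ H ⊢ z ~ w → w Subset.∈ C → Reachable H w w′ → z ≡ w′ ⊎ H ⊢ z ~ w′
  walk near _ ε = near
  walk near w∈C (r ◅ rs) = walk (step near w∈C r) (from (comp w∈C _) (r ◅ ε)) rs
  spoke : ∀ {w} → w ≢ z → w Subset.∈ C → H ⊢ z ~ w
  spoke {w} w≢z w∈C with walk (inj₁ refl) z∈C (to (comp z∈C w) w∈C)
  ... | inj₁ z≡w = contradiction (sym z≡w) w≢z
  ... | inj₂ r = r
  indep : ∀ {w w′} → w ≢ z → w′ ≢ z → w Subset.∈ C → w′ Subset.∈ C → ¬ (H ⊢ w ~ w′)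
  indep w≢z w′≢z w∈C w′∈C r with star (spoke w≢z w∈C) r (~-sym (spoke w′≢z w′∈C))
  ... | inj₁ eq = w′≢z (sym eq)
  ... | inj₂ eq = w≢z eq

K₁-starLike : ∀ m → StarLike (K 1 m)
K₁-starLike m {a} {b} {c} {d} = go a b c d
  where
  go : ∀ a b c d → K 1 m ⊢ a ~ b → K 1 m ⊢ b ~ c → K 1 m ⊢ c ~ d → a ≡ c ⊎ b ≡ d
  go zero    (suc b) zero    d       _ _ _ = inj₁ refl
  go (suc a) zero    (suc c) zero    _ _ _ = inj₂ refl

isStar⇒starLike : ∀ {H} → IsStar H → StarLike H
isStar⇒starLike (m , φ , adj) ab bc cd with K₁-starLike m (to (adj _ _) ab) (to (adj _ _) bc) (to (adj _ _) cd)
... | inj₁ eq = inj₁ (Injection.injective (↔⇒↣ φ) eq)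
... | inj₂ eq = inj₂ (Injection.injective (↔⇒↣ φ) eq)

¬¬-∀Fin : ∀ {n} {P : Fin n → Set} → (∀ i → ¬ ¬ P i) → ¬ ¬ (∀ i → P i)
¬¬-∀Fin {zero} _ k = k λ ()
¬¬-∀Fin {suc n} f k = f zero λ p → ¬¬-∀Fin (f ∘ suc) λ ps → k λ { zero → p ; (suc i) → ps i }

-- Components exist as subsets only up to double negation.
isStarForest⇒starLike : ∀ H → IsStarForest H → ∀ {a b c d} →
  H ⊢ a ~ b → H ⊢ b ~ c → H ⊢ c ~ d → ¬ ¬ (a ≡ c ⊎ b ≡ d)
isStarForest⇒starLike H forest {a} {b} {c} {d} ab bc cd k =
  ¬¬-∀Fin {P = λ v → Dec (Reachable H a v)} (λ _ → ¬¬-excluded-middle) λ reach? → let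
    open Graph H using (~-sym)
    C = subset reach?
    ∈C = ∈-subset⁺ reach?
    comp : IsComponent H C
    comp = (a , ∈C ε) , λ {u} u∈ v → mk⇔
      (λ v∈ → reverse ~-sym (∈-subset⁻ reach? u∈) ◅◅ ∈-subset⁻ reach? v∈)
      (λ uv → ∈C (∈-subset⁻ reach? u∈ ◅◅ uv))
    at = vertex-onto H (Subset._∈? C)
    i , i≡ = at (∈C ε)
    j , j≡ = at (∈C (ab ◅ ε))
    l , l≡ = at (∈C (ab ◅ bc ◅ ε))
    p , p≡ = at (∈C (ab ◅ bc ◅ cd ◅ ε))
    edge : ∀ {u v u′ v′} → u′ ≡ u → v′ ≡ v → H ⊢ u ~ v → H ⊢ u′ ~ v′
    edge = λ { refl refl r → r }
    in k (case isStar⇒starLike {induced H (Subset._∈? C)} (forest C comp) {i} {j} {l} {p}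
      (edge i≡ j≡ ab) (edge j≡ l≡ bc) (edge l≡ p≡ cd) of λ
      { (inj₁ eq) → inj₁ (trans (sym i≡) (trans (cong (vertex H (Subset._∈? C)) eq) l≡))
      ; (inj₂ eq) → inj₂ (trans (sym j≡) (trans (cong (vertex H (Subset._∈? C)) eq) p≡)) })

module _ (G : Graph) {k : ℕ} (c : V G → Fin k) where

  private
    two? : ∀ a b → Decidable (λ v → c v ≡ a ⊎ c v ≡ b)
    two? a b v = (c v Fin.≟ a) ⊎-dec (c v Fin.≟ b)

    two-colours : ∀ {a b x y z : Fin k} → x ≡ a ⊎ x ≡ b → y ≡ a ⊎ y ≡ b → z ≡ a ⊎ z ≡ b → x ≢ y → y ≢ z → x ≡ z
    two-colours (inj₁ refl) _ (inj₁ refl) _ _ = refl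
    two-colours (inj₂ refl) _ (inj₂ refl) _ _ = refl
    two-colours (inj₁ refl) (inj₁ refl) (inj₂ refl) p q = contradiction refl p
    two-colours (inj₁ refl) (inj₂ refl) (inj₂ refl) p q = contradiction refl q
    two-colours (inj₂ refl) (inj₁ refl) (inj₁ refl) p q = contradiction refl q
    two-colours (inj₂ refl) (inj₂ refl) (inj₁ refl) p q = contradiction refl p

  good⇒star : IsGood G c → IsStarColoring G c
  good⇒star (proper , path) = proper , λ a b _ → starLike⇒isStarForest (induced G (two? a b))
    λ {i} {j} {l} {m} ij jl lm →
      let P = vertex-P G (two? a b) in
      case path ij jl lm (two-colours (P i) (P j) (P l) (proper ij) (proper jl))
                         (two-colours (P j) (P l) (P m) (proper jl) (proper lm)) of λ
      { (inj₁ eq) → inj₁ (vertex-inj G (two? a b) eq) ; (inj₂ eq) → inj₂ (vertex-inj G (two? a b) eq) }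

  star⇒no-bicoloured-path : IsStarColoring G c → ∀ {u v w x} → G ⊢ u ~ v → G ⊢ v ~ w → G ⊢ w ~ x →
    c u ≡ c w → c v ≡ c x → u ≢ w → ¬ (v ≢ x)
  star⇒no-bicoloured-path (proper , forest) {u} {v} {w} {x} uv vw wx cu≡cw cv≡cx u≢w v≢x =
    isStarForest⇒starLike (induced G P?) (forest (c u) (c v) (proper uv)) {i} {j} {l} {m}
      (edge i≡ j≡ uv) (edge j≡ l≡ vw) (edge l≡ m≡ wx) λ
      { (inj₁ eq) → u≢w (trans (sym i≡) (trans (cong (vertex G P?) eq) l≡))
      ; (inj₂ eq) → v≢x (trans (sym j≡) (trans (cong (vertex G P?) eq) m≡)) }
    where
    P? = two? (c u) (c v)
    at : ∀ {y} → c y ≡ c u ⊎ c y ≡ c v → ∃[ i ] vertex G P? i ≡ y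
    at = vertex-onto G P?
    i = proj₁ (at {u} (inj₁ refl))
    i≡ = proj₂ (at {u} (inj₁ refl))
    j = proj₁ (at {v} (inj₂ refl))
    j≡ = proj₂ (at {v} (inj₂ refl))
    l = proj₁ (at {w} (inj₁ (sym cu≡cw)))
    l≡ = proj₂ (at {w} (inj₁ (sym cu≡cw)))
    m = proj₁ (at {x} (inj₂ (sym cv≡cx)))
    m≡ = proj₂ (at {x} (inj₂ (sym cv≡cx)))
    edge : ∀ {y z y′ z′} → y′ ≡ y → z′ ≡ z → G ⊢ y ~ z → G ⊢ y′ ~ z′
    edge refl refl r = r

-- Forests as subgraphs of 1-subdivisions

least : ∀ {P : ℕ → Set} → (∀ n → Dec (P n)) → ∀ {n} → P n → ∃[ m ] P m × (∀ {k} → k < m → ¬ P k)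
least {P} P? {n} p with search (suc n)
  where
  search : ∀ n → (∃[ m ] P m × (∀ {k} → k < m → ¬ P k)) ⊎ (∀ {k} → k < n → ¬ P k)
  search zero = inj₂ λ ()
  search (suc n) with search n
  ... | inj₁ found = inj₁ found
  ... | inj₂ none with P? n
  ...   | yes p = inj₁ (n , p , none)
  ...   | no ¬p = inj₂ λ k<1+n q → case m≤n⇒m<n∨m≡n (s≤s⁻¹ k<1+n) of λ
          { (inj₁ k<n) → none k<n q ; (inj₂ refl) → ¬p q }
... | inj₁ found = found
... | inj₂ none = contradiction p (none ≤-refl)

module _ (G : Graph) where
  open Graph G using (_~?_; ~-sym; ~-irrefl)

  -- The first repetition of a walk that never turns back closes a cycle.
  walk⇒cycle : (w : ℕ → V G) → (∀ i → G ⊢ w i ~ w (suc i)) → (∀ i → w (suc (suc i)) ≢ w i) → HasCycle G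
  walk⇒cycle w adj forward
    with i , j , i<j , eq ← Fin.pigeonhole ≤-refl (w ∘ toℕ {suc (order G)})
    with least (λ j → Fin.any? {j} λ i → w (toℕ i) Fin.≟ w j)
           {toℕ j} (Fin.fromℕ< i<j , trans (cong w (Fin.toℕ-fromℕ< i<j)) eq)
  -- The first repetition closes a walk of `j` minus `i` edges. One edge would be a loop and two
  -- would turn back, so there are at least three.
  ... | j , (i , wi≡wj) , first with m≤n⇒∃[o]m+o≡n (Fin.toℕ<n i)
  ...   | zero , p = contradiction (subst (G ⊢ w (toℕ i) ~_) (trans (cong w (trans (sym (+-identityʳ _)) p)) (sym wi≡wj)) (adj (toℕ i))) ~-irrefl
  ...   | suc zero , p = contradiction (trans (cong w (trans (sym (trans (+-suc _ 0) (cong suc (+-identityʳ _)))) p)) (sym wi≡wj)) (forward (toℕ i))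
  ...   | suc (suc k) , p = k , c , c-inj , c-adj , c-close
    where
    a = toℕ i
    a+3+k≡j : a + (3 + k) ≡ j
    a+3+k≡j = trans (+-suc a (2 + k)) p
    c : Fin (3 + k) → V G
    c x = w (a + toℕ x)
    -- A repetition within the segment would come before the first one.
    differ : ∀ {x y : Fin (3 + k)} → toℕ x < toℕ y → c x ≢ c y
    differ {x} {y} x<y eq = first (<-≤-trans (+-monoʳ-< a (Fin.toℕ<n y)) (≤-reflexive a+3+k≡j))
      (Fin.fromℕ< (+-monoʳ-< a x<y) , trans (cong w (Fin.toℕ-fromℕ< (+-monoʳ-< a x<y))) eq)
    c-inj : Injective _≡_ _≡_ c
    c-inj {x} {y} eq with <-cmp (toℕ x) (toℕ y)
    ... | B.tri< x<y _ _ = contradiction eq (differ x<y)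
    ... | B.tri≈ _ x≡y _ = Fin.toℕ-injective x≡y
    ... | B.tri> _ _ y<x = contradiction (sym eq) (differ y<x)
    c-adj : ∀ (x : Fin (2 + k)) → G ⊢ c (inject₁ x) ~ c (suc x)
    c-adj x = subst₂ (λ l m → G ⊢ w l ~ w m) (cong (a +_) (sym (Fin.toℕ-inject₁ x))) (sym (+-suc a (toℕ x))) (adj (a + toℕ x))
    c-close : G ⊢ c (fromℕ (2 + k)) ~ c zero
    c-close = subst₂ (λ u v → G ⊢ u ~ v) (cong (λ l → w (a + l)) (sym (Fin.toℕ-fromℕ (2 + k))))
      (trans (cong w p) (trans (sym wi≡wj) (cong w (sym (+-identityʳ a))))) (adj (a + (2 + k)))

  min-degree-2⇒cycle : ∀ {S} → Unique S → (∀ {v} → v ∈ S → 2 ≤ degree _~?_ S v) → ∀ {v} → v ∈ S → HasCycle G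
  min-degree-2⇒cycle {S} uS high {v₀} v₀∈ = walk⇒cycle (cur ∘ state) adj forward
    where
    record State : Set where
      constructor mk
      field
        prev cur : V G
        cur∈     : cur ∈ S
    open State
    next : ∀ u {v} → v ∈ S → ∃[ w ] w ∈ S × G ⊢ v ~ w × w ≢ u
    next u {v} v∈ with filter (v ~?_) S in eq | high v∈ | Unique.filter⁺ (v ~?_) uS
    ... | [] | () | _
    ... | x ∷ [] | s≤s () | _
    ... | x ∷ y ∷ _ | _ | u′ with x Fin.≟ u
    ...   | no x≢u = let x∈ , r = ∈-filter⁻ (v ~?_) {xs = S} (subst (x ∈_) (sym eq) (here refl)) in x , x∈ , r , x≢u
    ...   | yes refl = let y∈ , r = ∈-filter⁻ (v ~?_) {xs = S} (subst (y ∈_) (sym eq) (there (here refl))) in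
                       y , y∈ , r , λ { refl → unique-∉ u′ (here refl) }
    step : State → State
    step s = let w , w∈ , _ = next (prev s) (cur∈ s) in mk (cur s) w w∈
    state : ℕ → State
    -- There is no previous vertex at the start. Forbidding a return to `v₀` itself costs nothing,
    -- as there are no loops.
    state zero = mk v₀ v₀ v₀∈
    state (suc i) = step (state i)
    adj : ∀ i → G ⊢ cur (state i) ~ cur (state (suc i))
    adj i = proj₁ (proj₂ (proj₂ (next (prev (state i)) (cur∈ (state i)))))
    forward : ∀ i → cur (state (suc (suc i))) ≢ cur (state i)
    forward i = proj₂ (proj₂ (proj₂ (next (prev (state (suc i))) (cur∈ (state (suc i))))))

  -- Read from the end, the list builds the graph by adding isolated vertices and leaves.
  data Peeling : List (V G) → Set where
    []       : Peeling []
    isolated : ∀ {v L} → v ∉ L → (∀ {u} → u ∈ L → ¬ (G ⊢ v ~ u)) → Peeling L → Peeling (v ∷ L)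
    pendant  : ∀ {v p L} → v ∉ L → p ∈ L → G ⊢ v ~ p → (∀ {u} → u ∈ L → G ⊢ v ~ u → u ≡ p) →
               Peeling L → Peeling (v ∷ L)

  -- Deleting vertices of degree at most 1 exhausts a forest: a non-empty remainder would contain a
  -- cycle.
  forest⇒peeling : IsForest G → ∃[ L ] Peeling L × (∀ v → v ∈ L)
  forest⇒peeling forest with core _~?_ 2 Peelable add (allFin (order G))
    where
    Peelable : List (V G) → Set
    Peelable S = ∃[ L ] Peeling L × S ⊆ L × L ⊆ S
    add : ∀ S {v} → v ∈ S → degree _~?_ S v < 2 → Peelable (S ∖ v) → Peelable S
    add S {v} v∈ low (L , peel , S∖v⊆L , L⊆S∖v) = v ∷ L , peel′ , S⊆ , ⊆S
      where
      S⊆ : S ⊆ v ∷ L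
      S⊆ {u} u∈ with u Fin.≟ v
      ... | yes refl = here refl
      ... | no u≢v = there (S∖v⊆L (∈-∖⁺ u∈ u≢v))
      ⊆S : v ∷ L ⊆ S
      ⊆S (here refl) = v∈
      ⊆S (there u∈) = proj₁ (∈-filter⁻ _ (L⊆S∖v u∈))
      v∉ : v ∉ L
      v∉ v∈L = proj₂ (∈-filter⁻ _ {xs = S} (L⊆S∖v v∈L)) refl
      nbr : ∀ {u} → u ∈ L → G ⊢ v ~ u → u ∈ filter (v ~?_) S
      nbr u∈ r = ∈-filter⁺ (v ~?_) (⊆S (there u∈)) r
      peel′ : Peeling (v ∷ L)
      peel′ with filter (v ~?_) S in eq | s≤s⁻¹ low
      ... | [] | _ = isolated v∉ (λ u∈ r → case subst (_ ∈_) eq (nbr u∈ r) of λ ()) peel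
      ... | p ∷ [] | _ = let p∈ , r = ∈-filter⁻ (v ~?_) {xs = S} (subst (p ∈_) (sym eq) (here refl)) in
            pendant v∉ (S∖v⊆L (∈-∖⁺ p∈ λ { refl → ~-irrefl r })) r
              (λ u∈ r → case subst (_ ∈_) eq (nbr u∈ r) of λ { (here eq) → eq }) peel
      ... | _ ∷ _ ∷ _ | s≤s ()
  ... | [] , _ , _ , _ , up = let L , peel , ⊆L , _ = up ([] , [] , (λ ()) , λ ()) in L , peel , λ v → ⊆L (∈-allFin v)
  ... | v ∷ S , _ , uS , high , _ = contradiction (min-degree-2⇒cycle (uS (Unique.allFin⁺ _)) high (here refl)) forest

  -- The vertices of side true are placed on vertices of a tree, those of side false on edges.
  Sided : (V G → Bool) → Set
  Sided side = (∀ u v → G ⊢ u ~ v → side u ≢ side v)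
    × (∀ b → side b ≡ false → ∀ x y z → G ⊢ x ~ b → G ⊢ y ~ b → G ⊢ z ~ b → x ≡ y ⊎ y ≡ z ⊎ x ≡ z)

  sided? : ∀ side → Dec (Sided side)
  sided? side =
    Fin.all? (λ u → Fin.all? λ v → (u ~? v) →-dec ¬? (side u ≟ᵇ side v))
    ×-dec Fin.all? (λ b → (side b ≟ᵇ false) →-dec Fin.all? λ x → Fin.all? λ y → Fin.all? λ z →
      (x ~? b) →-dec ((y ~? b) →-dec ((z ~? b) →-dec ((x Fin.≟ y) ⊎-dec ((y Fin.≟ z) ⊎-dec (x Fin.≟ z))))))

  module _ (side : V G → Bool) where

    -- An end q of the edge of b is occupied by a neighbour of b, or available for one.
    Slot : List (V G) → ∀ {m} → RootedTree (suc m) → (V G → Fin (suc (suc m))) → (V G → Fin (suc m)) →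
      V G → Fin (suc (suc m)) → Set
    Slot L T pos arc b q = (∃[ a ] a ∈ L × side a ≡ true × pos a ≡ q)
      ⊎ (∀ a → a ∈ L → side a ≡ true → pos a ≢ q)
        × (∀ b′ → b′ ∈ L → side b′ ≡ false → Incident T q (arc b′) → b′ ≡ b)

    -- Incidence has to reflect adjacency, so that the copy is induced. The tree has at least one
    -- edge, which gives the total functions `pos` and `arc` values to take.
    record Placed (L : List (V G)) {m} (T : RootedTree (suc m)) (pos : V G → Fin (suc (suc m))) (arc : V G → Fin (suc m)) : Set where
      field
        pos-inj : ∀ {a a′} → a ∈ L → a′ ∈ L → side a ≡ true → side a′ ≡ true → pos a ≡ pos a′ → a ≡ a′
        arc-inj : ∀ {b b′} → b ∈ L → b′ ∈ L → side b ≡ false → side b′ ≡ false → arc b ≡ arc b′ → b ≡ b′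
        adj⇒inc : ∀ {a b} → a ∈ L → b ∈ L → side a ≡ true → side b ≡ false → G ⊢ a ~ b → Incident T (pos a) (arc b)
        inc⇒adj : ∀ {a b} → a ∈ L → b ∈ L → side a ≡ true → side b ≡ false → Incident T (pos a) (arc b) → G ⊢ a ~ b
        slots   : ∀ {b} → b ∈ L → side b ≡ false → ∀ q → Incident T q (arc b) → Slot L T pos arc b q

    placed-cong : ∀ {L m} {T : RootedTree (suc m)} {pos pos′ arc arc′} → (∀ {u} → u ∈ L → pos u ≡ pos′ u) →
      (∀ {u} → u ∈ L → arc u ≡ arc′ u) → Placed L T pos arc → Placed L T pos′ arc′
    placed-cong {T = T} p≡ a≡ P = record
      { pos-inj = λ a∈ a′∈ sa sa′ eq → pos-inj a∈ a′∈ sa sa′ (trans (p≡ a∈) (trans eq (sym (p≡ a′∈))))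
      ; arc-inj = λ b∈ b′∈ sb sb′ eq → arc-inj b∈ b′∈ sb sb′ (trans (a≡ b∈) (trans eq (sym (a≡ b′∈))))
      ; adj⇒inc = λ a∈ b∈ sa sb r → subst₂ (Incident T) (p≡ a∈) (a≡ b∈) (adj⇒inc a∈ b∈ sa sb r)
      ; inc⇒adj = λ a∈ b∈ sa sb r → inc⇒adj a∈ b∈ sa sb (subst₂ (Incident T) (sym (p≡ a∈)) (sym (a≡ b∈)) r)
      ; slots = λ b∈ sb q r → case slots b∈ sb q (subst (Incident T q) (sym (a≡ b∈)) r) of λ
        { (inj₁ (a , a∈ , sa , eq)) → inj₁ (a , a∈ , sa , trans (sym (p≡ a∈)) eq)
        ; (inj₂ (unocc , only)) → inj₂ ((λ a a∈ sa eq → unocc a a∈ sa (trans (p≡ a∈) eq))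
            , λ b′ b′∈ sb′ r → only b′ b′∈ sb′ (subst (Incident T q) (sym (a≡ b′∈)) r)) } }
      where open Placed P

    placed-grow : ∀ {L m} {T : RootedTree (suc m)} {pos arc} q₀ → Placed L T pos arc →
      Placed L (grow T q₀) (suc ∘ pos) (suc ∘ arc)
    placed-grow q₀ P = record
      { pos-inj = λ a∈ a′∈ sa sa′ eq → pos-inj a∈ a′∈ sa sa′ (Fin.suc-injective eq)
      ; arc-inj = λ b∈ b′∈ sb sb′ eq → arc-inj b∈ b′∈ sb sb′ (Fin.suc-injective eq)
      ; adj⇒inc = adj⇒inc ; inc⇒adj = inc⇒adj
      ; slots = λ { b∈ sb zero () ; b∈ sb (suc q) r → case slots b∈ sb q r of λ
        { (inj₁ (a , a∈ , sa , eq)) → inj₁ (a , a∈ , sa , cong suc eq)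
        ; (inj₂ (unocc , only)) → inj₂ ((λ a a∈ sa eq → unocc a a∈ sa (Fin.suc-injective eq)) , only) } } }
      where open Placed P

    place-vertex : ∀ {L m v} {T : RootedTree (suc m)} {pos arc} → Placed L T pos arc → side v ≡ true →
      (∀ {a} → a ∈ L → side a ≡ true → pos a ≢ pos v) →
      (∀ {b} → b ∈ L → side b ≡ false → G ⊢ v ~ b → Incident T (pos v) (arc b)) →
      (∀ {b} → b ∈ L → side b ≡ false → Incident T (pos v) (arc b) → G ⊢ v ~ b) →
      Placed (v ∷ L) T pos arc
    place-vertex {L} {v = v} {T} {pos} {arc} P sv new v⇒inc inc⇒v = record
      { pos-inj = λ { (here refl) (here refl) _ _ _ → refl
                    ; (here refl) (there a′∈) _ sa′ eq → contradiction (sym eq) (new a′∈ sa′)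
                    ; (there a∈) (here refl) sa _ eq → contradiction eq (new a∈ sa)
                    ; (there a∈) (there a′∈) → pos-inj a∈ a′∈ }
      ; arc-inj = λ b∈ b′∈ sb sb′ → arc-inj (tail b∈ sb) (tail b′∈ sb′) sb sb′
      ; adj⇒inc = λ { (here refl) b∈ _ sb → v⇒inc (tail b∈ sb) sb ; (there a∈) b∈ sa sb → adj⇒inc a∈ (tail b∈ sb) sa sb }
      ; inc⇒adj = λ { (here refl) b∈ _ sb → inc⇒v (tail b∈ sb) sb ; (there a∈) b∈ sa sb → inc⇒adj a∈ (tail b∈ sb) sa sb }
      ; slots = slots′ }
      where
      open Placed P
      tail : ∀ {b} → b ∈ v ∷ L → side b ≡ false → b ∈ L
      tail (here refl) sb = case trans (sym sv) sb of λ ()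
      tail (there b∈) _ = b∈
      slots′ : ∀ {b} → b ∈ v ∷ L → side b ≡ false → ∀ q → Incident T q (arc b) → Slot (v ∷ L) T pos arc b q
      slots′ b∈ sb q r with slots (tail b∈ sb) sb q r
      ... | inj₁ (a , a∈ , sa , eq) = inj₁ (a , there a∈ , sa , eq)
      ... | inj₂ (unocc , only) with pos v Fin.≟ q
      ...   | yes eq = inj₁ (v , here refl , sv , eq)
      ...   | no ne = inj₂ ((λ { _ (here refl) _ → ne ; a (there a∈) → unocc a a∈ }) , λ b′ b′∈ sb′ → only b′ (tail b′∈ sb′) sb′)

    place-edge : ∀ {L m v} {T : RootedTree (suc m)} {pos arc} → Placed L T pos arc → side v ≡ false →
      (∀ {b} → b ∈ L → side b ≡ false → arc b ≢ arc v) →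
      (∀ {a} → a ∈ L → side a ≡ true → G ⊢ a ~ v → Incident T (pos a) (arc v)) →
      (∀ {a} → a ∈ L → side a ≡ true → Incident T (pos a) (arc v) → G ⊢ a ~ v) →
      (∀ q → Incident T q (arc v) → (∃[ a ] a ∈ L × side a ≡ true × pos a ≡ q)
        ⊎ (∀ a → a ∈ L → side a ≡ true → pos a ≢ q)
          × (∀ b → b ∈ L → side b ≡ false → ¬ Incident T q (arc b))) →
      Placed (v ∷ L) T pos arc
    place-edge {L} {v = v} {T} {pos} {arc} P sv new v⇒inc inc⇒v slots-v = record
      { pos-inj = λ a∈ a′∈ sa sa′ → pos-inj (tail a∈ sa) (tail a′∈ sa′) sa sa′
      ; arc-inj = λ { (here refl) (here refl) _ _ _ → refl
                    ; (here refl) (there b′∈) _ sb′ eq → contradiction (sym eq) (new b′∈ sb′)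
                    ; (there b∈) (here refl) sb _ eq → contradiction eq (new b∈ sb)
                    ; (there b∈) (there b′∈) → arc-inj b∈ b′∈ }
      ; adj⇒inc = λ { a∈ (here refl) sa _ → v⇒inc (tail a∈ sa) sa ; a∈ (there b∈) sa sb → adj⇒inc (tail a∈ sa) b∈ sa sb }
      ; inc⇒adj = λ { a∈ (here refl) sa _ → inc⇒v (tail a∈ sa) sa ; a∈ (there b∈) sa sb → inc⇒adj (tail a∈ sa) b∈ sa sb }
      ; slots = slots′ }
      where
      open Placed P
      tail : ∀ {a} → a ∈ v ∷ L → side a ≡ true → a ∈ L
      tail (here refl) sa = case trans (sym sv) sa of λ ()
      tail (there a∈) _ = a∈
      slots′ : ∀ {b} → b ∈ v ∷ L → side b ≡ false → ∀ q → Incident T q (arc b) → Slot (v ∷ L) T pos arc b q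
      slots′ (here refl) sb q r with slots-v q r
      ... | inj₁ (a , a∈ , sa , eq) = inj₁ (a , there a∈ , sa , eq)
      ... | inj₂ (unocc , none) = inj₂ ((λ a a∈ sa → unocc a (tail a∈ sa) sa) ,
            λ { _ (here refl) _ _ → refl ; b′ (there b′∈) sb′ r′ → contradiction r′ (none b′ b′∈ sb′) })
      slots′ (there b∈) sb q r with slots b∈ sb q r
      ... | inj₁ (a , a∈ , sa , eq) = inj₁ (a , there a∈ , sa , eq)
      -- If the new edge also met `q`, then by `slots-v` either `q` would be occupied or no old edge
      -- would meet it; both are false.
      ... | inj₂ (unocc , only) = inj₂ ((λ a a∈ sa → unocc a (tail a∈ sa) sa) , λ
            { _ (here refl) _ r′ → case slots-v q r′ of λ
              { (inj₁ (a , a∈ , sa , eq)) → contradiction eq (unocc a a∈ sa)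
              ; (inj₂ (_ , none)) → contradiction r (none _ b∈ sb) }
            ; b′ (there b′∈) sb′ r′ → only b′ b′∈ sb′ r′ })

    Placement : List (V G) → Set
    Placement L = ∃[ m ] Σ[ T ∈ RootedTree (suc m) ] ∃[ pos ] ∃[ arc ] Placed L T pos arc

-- The lower end is the younger one, since a new vertex gets number 0. In this order the ends form
-- an entry of `edges`.
lower upper : ∀ {m} → RootedTree m → Fin m → Fin (suc m)
lower (grow T p) zero    = zero
lower (grow T p) (suc e) = suc (lower T e)
upper (grow T p) zero    = suc p
upper (grow T p) (suc e) = suc (upper T e)

lower<upper : ∀ {m} (T : RootedTree m) e → lower T e Fin.< upper T e
lower<upper (grow T p) zero    = s≤s z≤n
lower<upper (grow T p) (suc e) = s≤s (lower<upper T e)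

incident-lower : ∀ {m} (T : RootedTree m) e → Incident T (lower T e) e
incident-lower (grow T p) zero    = tt
incident-lower (grow T p) (suc e) = incident-lower T e

incident-upper : ∀ {m} (T : RootedTree m) e → Incident T (upper T e) e
incident-upper (grow T p) zero    = refl
incident-upper (grow T p) (suc e) = incident-upper T e

incident⇒end : ∀ {m} (T : RootedTree m) {i e} → Incident T i e → i ≡ lower T e ⊎ i ≡ upper T e
incident⇒end (grow T p) {zero}  {zero}  _    = inj₁ refl
incident⇒end (grow T p) {suc i} {zero}  refl = inj₂ refl
incident⇒end (grow T p) {suc i} {suc e} r    = case incident⇒end T r of λ
  { (inj₁ eq) → inj₁ (cong suc eq) ; (inj₂ eq) → inj₂ (cong suc eq) }

lower-upper-adj : ∀ {m} (T : RootedTree m) e → TreeAdj T (lower T e) (upper T e)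
lower-upper-adj (grow T p) zero    = refl
lower-upper-adj (grow T p) (suc e) = lower-upper-adj T e

-- Every edge arrives together with its lower end.
lower-inj : ∀ {m} (T : RootedTree m) {e f} → lower T e ≡ lower T f → e ≡ f
lower-inj (grow T p) {zero}  {zero}  _  = refl
lower-inj (grow T p) {suc e} {suc f} eq = cong suc (lower-inj T (Fin.suc-injective eq))

update : ∀ {n} {A : Set} → (Fin n → A) → Fin n → A → Fin n → A
update f v x u with u Fin.≟ v
... | yes _ = x
... | no  _ = f u

update-new : ∀ {n} {A : Set} (f : Fin n → A) v {x} → update f v x v ≡ x
update-new f v with v Fin.≟ v
... | yes _ = refl
... | no v≢v = contradiction refl v≢v

update-old : ∀ {n} {A : Set} (f : Fin n → A) {v x u} → u ≢ v → f u ≡ update f v x u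
update-old f {v} {x} {u} u≢v with u Fin.≟ v
... | yes u≡v = contradiction u≡v u≢v
... | no _ = refl

module _ (G : Graph) (side : V G → Bool) (sided : Sided G side) where
  open Graph G using (~-sym)

  private
    ∉⇒≢ : ∀ {v : V G} {L u} → v ∉ L → u ∈ L → u ≢ v
    ∉⇒≢ v∉ u∈ refl = v∉ u∈

    ≢true : ∀ {b} → b ≢ true → b ≡ false
    ≢true {false} _ = refl
    ≢true {true} ne = contradiction refl ne

    ≢false : ∀ {b} → b ≢ false → b ≡ true
    ≢false {true} _ = refl
    ≢false {false} ne = contradiction refl ne

    clash : ∀ {u v b} → side u ≡ b → side v ≡ b → ¬ (G ⊢ u ~ v)
    clash su sv r = proj₁ sided _ _ r (trans su (sym sv))

    -- Since b has at most two neighbours, one of which is new, an end of its edge is available.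
    free-end : ∀ {L m T pos arc} → Placed G side L {m} T pos arc → ∀ {v b} → v ∉ L → b ∈ L → side b ≡ false →
      G ⊢ v ~ b → ∃[ q ] Incident T q (arc b) × (∀ a → a ∈ L → side a ≡ true → pos a ≢ q)
        × (∀ b′ → b′ ∈ L → side b′ ≡ false → Incident T q (arc b′) → b′ ≡ b)
    free-end {L} {T = T} {pos} {arc} P {v} {b} v∉ b∈ sb r
      with Placed.slots P b∈ sb (lower T (arc b)) (incident-lower T (arc b))
         | Placed.slots P b∈ sb (upper T (arc b)) (incident-upper T (arc b))
    ... | inj₂ (unocc , only) | _ = _ , incident-lower T (arc b) , unocc , only
    ... | inj₁ _ | inj₂ (unocc , only) = _ , incident-upper T (arc b) , unocc , only
    ... | inj₁ (x , x∈ , sx , px) | inj₁ (y , y∈ , sy , py)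
      with proj₂ sided b sb v x y r
             (Placed.inc⇒adj P x∈ b∈ sx sb (subst (λ q → Incident T q (arc b)) (sym px) (incident-lower T (arc b))))
             (Placed.inc⇒adj P y∈ b∈ sy sb (subst (λ q → Incident T q (arc b)) (sym py) (incident-upper T (arc b))))
    ...   | inj₁ refl = contradiction x∈ v∉
    ...   | inj₂ (inj₁ refl) = contradiction (trans (sym px) py) (Fin.<⇒≢ (lower<upper T (arc b)))
    ...   | inj₂ (inj₂ refl) = contradiction y∈ v∉

  -- Leaf by leaf: an isolated vertex goes to a fresh vertex or a fresh edge of the tree. A leaf on
  -- side true takes a free end of the edge of its neighbour, and one on side false becomes a fresh
  -- edge grown at the position of its neighbour.
  placement : ∀ {L} → Peeling G L → Placement G side L
  placement [] = 0 , grow root zero , const zero , const zero , record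
    { pos-inj = λ () ; arc-inj = λ () ; adj⇒inc = λ () ; inc⇒adj = λ () ; slots = λ () }
  placement (isolated {v} {L} v∉ alone peel) with side v in sv | placement peel
  ... | true | m , T , pos , arc , P = suc m , grow T zero , pos′ , suc ∘ arc ,
    place-vertex G side (placed-cong G side (λ u∈ → update-old (suc ∘ pos) (∉⇒≢ v∉ u∈)) (λ _ → refl) (placed-grow G side zero P)) sv
      (λ a∈ _ eq → case trans (update-old (suc ∘ pos) (∉⇒≢ v∉ a∈)) (trans eq new) of λ ())
      (λ b∈ _ r → contradiction r (alone b∈))
      (λ b∈ sb r → ⊥-elim (subst (λ q → Incident (grow T zero) q (suc (arc _))) new r))
    where
    pos′ = update (suc ∘ pos) v zero
    new = update-new (suc ∘ pos) v {zero}
  ... | false | m , T , pos , arc , P = suc (suc m) , T′ , pos₂ , arc′ ,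
    place-edge G side (placed-cong G side (λ _ → refl) (λ u∈ → update-old arc₂ (∉⇒≢ v∉ u∈))
        (placed-grow G side zero (placed-grow G side zero P))) sv
      (λ b∈ _ eq → case trans (update-old arc₂ (∉⇒≢ v∉ b∈)) (trans eq new) of λ ())
      (λ a∈ _ r → contradiction (~-sym r) (alone a∈))
      (λ {a} a∈ _ r → case subst (Incident T′ (pos₂ a)) new r of λ ())
      (λ q r → inj₂ (available q (subst (Incident T′ q) new r)))
    where
    -- Growing twice makes both ends of the last edge new, so no placed vertex or edge touches it.
    T′ = grow (grow T zero) zero
    pos₂ : V G → Fin (suc (suc (suc (suc m))))
    pos₂ u = suc (suc (pos u))
    arc₂ arc′ : V G → Fin (suc (suc (suc m)))
    arc₂ u = suc (suc (arc u))
    arc′ = update arc₂ v zero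
    new = update-new arc₂ v {zero}
    available : ∀ q → Incident T′ q zero → (∀ a → a ∈ L → side a ≡ true → pos₂ a ≢ q)
      × (∀ b → b ∈ L → side b ≡ false → ¬ Incident T′ q (arc′ b))
    available zero _ = (λ _ _ _ ()) , λ b b∈ _ r →
      subst (Incident T′ zero) (sym (update-old arc₂ (∉⇒≢ v∉ b∈))) r
    available (suc zero) _ = (λ _ _ _ ()) , λ b b∈ _ r →
      subst (Incident T′ (suc zero)) (sym (update-old arc₂ (∉⇒≢ v∉ b∈))) r
  placement (pendant {v} {p} {L} v∉ p∈ vp only-p peel) with side v in sv | placement peel
  ... | true | m , T , pos , arc , P
    with q , q-inc , unocc , only ← free-end P v∉ p∈ (≢true λ sp → clash sv sp vp) vp =
    m , T , update pos v q , arc ,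
    place-vertex G side (placed-cong G side (λ u∈ → update-old pos (∉⇒≢ v∉ u∈)) (λ _ → refl) P) sv
      (λ a∈ sa eq → unocc _ a∈ sa (trans (update-old pos (∉⇒≢ v∉ a∈)) (trans eq new)))
      (λ b∈ sb r → subst₂ (Incident T) (sym new) (cong arc (sym (only-p b∈ r))) q-inc)
      (λ b∈ sb r → subst (G ⊢ v ~_) (sym (only _ b∈ sb (subst (λ x → Incident T x (arc _)) new r))) vp)
    where new = update-new pos v
  ... | false | m , T , pos , arc , P = suc m , T′ , suc ∘ pos , arc′ ,
    place-edge G side (placed-cong G side (λ _ → refl) (λ u∈ → update-old (suc ∘ arc) (∉⇒≢ v∉ u∈)) (placed-grow G side (pos p) P)) sv
      (λ b∈ _ eq → case trans (update-old (suc ∘ arc) (∉⇒≢ v∉ b∈)) (trans eq new) of λ ())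
      (λ {a} a∈ _ r → subst (Incident T′ (suc (pos a))) (sym new) (cong pos (only-p a∈ (~-sym r))))
      (λ {a} a∈ sa r → subst (λ x → G ⊢ x ~ v) (sym (Placed.pos-inj P a∈ p∈ sa sp (subst (Incident T′ (suc (pos a))) new r))) (~-sym vp))
      (λ q r → slot q (subst (Incident T′ q) new r))
    where
    sp : side p ≡ true
    sp = ≢false λ sp → clash sv sp vp
    T′ = grow T (pos p)
    arc′ = update (suc ∘ arc) v zero
    new = update-new (suc ∘ arc) v {zero}
    slot : ∀ q → Incident T′ q zero → (∃[ a ] a ∈ L × side a ≡ true × suc (pos a) ≡ q)
      ⊎ (∀ a → a ∈ L → side a ≡ true → suc (pos a) ≢ q)
        × (∀ b → b ∈ L → side b ≡ false → ¬ Incident T′ q (arc′ b))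
    slot zero _ = inj₂ ((λ _ _ _ ()) , λ b b∈ _ r →
      subst (Incident T′ zero) (sym (update-old (suc ∘ arc) (∉⇒≢ v∉ b∈))) r)
    slot (suc q) eq = inj₁ (p , p∈ , sp , cong suc (sym eq))

sided-forest⇒placement : ∀ G side → Sided G side → IsForest G → ∃[ L ] (∀ v → v ∈ L) × Placement G side L
sided-forest⇒placement G side sided forest =
  let L , peel , all∈ = forest⇒peeling G forest in L , all∈ , placement G side sided peel

placed⇒induced : ∀ {F side L m} {T : RootedTree (suc m)} {pos arc} → Sided F side → (∀ v → v ∈ L) →
  Placed F side L T pos arc → ∀ {G} → SubdivisionIn G T → F IsInducedSubgraphOf G
placed⇒induced {F} {side} {L} {m} {T} {pos} {arc} sided ∈L P {G} C = f , inj _ _ , λ u v → mk⇔ (adj⁺ u v) (adj⁻ u v)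
  where
  open Placed P
  open SubdivisionIn C
  open Graph G using () renaming (~-sym to G-sym)
  f : V F → V G
  f v = if side v then vert (pos v) else edge (arc v)
  inj : ∀ u v → f u ≡ f v → u ≡ v
  inj u v eq with side u in su | side v in sv
  ... | true  | true  = pos-inj (∈L u) (∈L v) su sv (vert-inj eq)
  ... | true  | false = contradiction eq vert≢edge
  ... | false | true  = contradiction (sym eq) vert≢edge
  ... | false | false = arc-inj (∈L u) (∈L v) su sv (edge-inj eq)
  adj⁺ : ∀ u v → F ⊢ u ~ v → G ⊢ f u ~ f v
  adj⁺ u v r with side u in su | side v in sv | proj₁ sided u v r
  ... | true  | true  | ne = contradiction refl ne
  ... | true  | false | _  = inc⁺ _ _ (adj⇒inc (∈L u) (∈L v) su sv r)
  ... | false | true  | _  = G-sym (inc⁺ _ _ (adj⇒inc (∈L v) (∈L u) sv su (Graph.~-sym F r)))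
  ... | false | false | ne = contradiction refl ne
  adj⁻ : ∀ u v → G ⊢ f u ~ f v → F ⊢ u ~ v
  adj⁻ u v r with side u in su | side v in sv
  ... | true  | true  = contradiction r (vert-vert _ _)
  ... | true  | false = inc⇒adj (∈L u) (∈L v) su sv (inc⁻ _ _ r)
  ... | false | true  = Graph.~-sym F (inc⇒adj (∈L v) (∈L u) sv su (inc⁻ _ _ (G-sym r)))
  ... | false | false = contradiction r (edge-edge _ _)

treeAdj? : ∀ {m} (T : RootedTree m) → B.Decidable (TreeAdj T)
treeAdj? root       _       _       = no λ ()
treeAdj? (grow T p) zero    zero    = no λ ()
treeAdj? (grow T p) zero    (suc j) = j Fin.≟ p
treeAdj? (grow T p) (suc i) zero    = i Fin.≟ p
treeAdj? (grow T p) (suc i) (suc j) = treeAdj? T i j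

treeAdj-sym : ∀ {m} (T : RootedTree m) i j → TreeAdj T i j → TreeAdj T j i
treeAdj-sym (grow T p) zero    (suc j) r = r
treeAdj-sym (grow T p) (suc i) zero    r = r
treeAdj-sym (grow T p) (suc i) (suc j) r = treeAdj-sym T i j r

treeAdj-irrefl : ∀ {m} (T : RootedTree m) i → ¬ TreeAdj T i i
treeAdj-irrefl (grow T p) (suc i) r = treeAdj-irrefl T i r

treeGraph : ∀ {m} → RootedTree m → Graph
treeGraph {m} T = record
  { order = suc m ; _~_ = TreeAdj T ; _~?_ = treeAdj? T
  ; ~-sym = treeAdj-sym T _ _ ; ~-irrefl = treeAdj-irrefl T _ }

treeGraph-reachable : ∀ {m} (T : RootedTree m) i j → Reachable (treeGraph T) i j
treeGraph-reachable root       zero    zero    = ε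
treeGraph-reachable (grow T p) zero    zero    = ε
treeGraph-reachable (grow T p) zero    (suc j) = refl ◅ gmap suc id (treeGraph-reachable T p j)
treeGraph-reachable (grow T p) (suc i) zero    = gmap suc id (treeGraph-reachable T i p) ◅◅ (refl ◅ ε)
treeGraph-reachable (grow T p) (suc i) (suc j) = gmap suc id (treeGraph-reachable T i j)

TwoNeighboursIn : ∀ {n} → Rel (Fin n) 0ℓ → Pred (Fin n) 0ℓ → Fin n → Set
TwoNeighboursIn _~_ X i = ∃[ j ] ∃[ l ] j ≢ l × X j × X l × (i ~ j) × (i ~ l)

-- The newest vertex is a leaf and cannot belong to `X`; removing it leaves a smaller tree. A cycle
-- would provide such an `X`.
treeAdj-no-core : ∀ {m} (T : RootedTree m) (X : Pred (Fin (suc m)) 0ℓ) →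
  (∀ {i} → X i → TwoNeighboursIn (TreeAdj T) X i) → ∀ i → ¬ X i
treeAdj-no-core root X two i x = case two x of λ { (_ , _ , _ , _ , _ , () , _) }
treeAdj-no-core (grow T p) X two = λ { zero → new∉ ; (suc i) → treeAdj-no-core T (X ∘ suc) two′ i }
  where
  new∉ : ¬ X zero
  new∉ x with two x
  ... | suc j , suc l , j≢l , _ , _ , j≡p , l≡p = j≢l (cong suc (trans j≡p (sym l≡p)))
  two′ : ∀ {i} → X (suc i) → TwoNeighboursIn (TreeAdj T) (X ∘ suc) i
  two′ x with two x
  ... | zero , _ , _ , x₀ , _ = contradiction x₀ new∉
  ... | suc j , zero , _ , _ , x₀ , _ = contradiction x₀ new∉
  ... | suc j , suc l , j≢l , xj , xl , ij , il = j , l , j≢l ∘ cong suc , xj , xl , ij , il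

cycle⇒core : ∀ G → ((k , c , _) : HasCycle G) → ∀ {v} → ∃ (λ x → c x ≡ v) →
  TwoNeighboursIn (G ⊢_~_) (λ v → ∃ λ x → c x ≡ v) v
cycle⇒core G (k , c , c-inj , adj , close) (x , refl) = two x
  where
  open Graph G using (~-sym)
  On : Pred (V G) 0ℓ
  On v = ∃ λ x → c x ≡ v
  next : ∀ (x : Fin (2 + k)) → TwoNeighboursIn (G ⊢_~_) On (c (suc x))
  next x with view x
  ... | ‵fromℕ = c (inject₁ x) , c zero , (λ eq → case c-inj eq of λ ()) ,
        (_ , refl) , (_ , refl) , ~-sym (adj x) , close
  ... | ‵inject₁ y = c (inject₁ x) , c (suc (suc y)) ,
        (λ eq → Fin.<⇒≢ (s≤s (≤-trans (≤-reflexive (trans (Fin.toℕ-inject₁ x) (Fin.toℕ-inject₁ y))) (n≤1+n _))) (c-inj eq)) ,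
        (_ , refl) , (_ , refl) , ~-sym (adj x) , adj (suc y)
  two : ∀ x → TwoNeighboursIn (G ⊢_~_) On (c x)
  two zero = c (suc zero) , c (fromℕ (2 + k)) , (λ eq → case c-inj eq of λ ()) , (_ , refl) , (_ , refl) , adj zero , ~-sym close
  two (suc x) = next x

treeGraph-isTree : ∀ {m} (T : RootedTree m) → IsTree (treeGraph T)
treeGraph-isTree T = (s≤s z≤n , treeGraph-reachable T) , λ cyc@(_ , c , _) →
  treeAdj-no-core T (λ v → ∃ λ x → c x ≡ v) (cycle⇒core (treeGraph T) cyc) (c zero) (zero , refl)

bipartite-adj : ∀ {m n} (R : Fin m → Fin n → Set) i j → R i j → BipartiteAdj R (splitAt m (i ↑ˡ n)) (splitAt m (m ↑ʳ j))
bipartite-adj {m} {n} R i j r = subst₂ (BipartiteAdj R) (sym (Fin.splitAt-↑ˡ m i n)) (sym (Fin.splitAt-↑ʳ m n j)) r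

∈-edges : ∀ G {u v} → u Fin.< v → G ⊢ u ~ v → (u , v) ∈ edges G
∈-edges G u<v r = ∈-filter⁺ _ (∈-cartesianProduct⁺ (∈-allFin _) (∈-allFin _)) (u<v , r)

placed⇒subgraph : ∀ {F side L m} {T : RootedTree (suc m)} {pos arc} → Sided F side → (∀ v → v ∈ L) →
  Placed F side L T pos arc → F IsSubgraphOf (1-subdivision (treeGraph T))
placed⇒subgraph {F} {side} {L} {m} {T} {pos} {arc} sided ∈L P = f , inj _ _ , adj _ _
  where
  open Placed P
  G = treeGraph T
  E = length (edges G)
  index∈ : ∀ e → (lower T e , upper T e) ∈ edges G
  index∈ e = ∈-edges G (lower<upper T e) (lower-upper-adj T e)
  index : Fin (suc m) → Fin E
  index e = Any.index (index∈ e)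
  index-ends : ∀ e → (lower T e , upper T e) ≡ lookup (edges G) (index e)
  index-ends e = lookup-index (index∈ e)
  index-inj : ∀ {e f} → index e ≡ index f → e ≡ f
  index-inj {e} {f} eq = lower-inj T (cong proj₁ (trans (index-ends e) (trans (cong (lookup (edges G)) eq) (sym (index-ends f)))))
  f : V F → V (1-subdivision G)
  f v = if side v then pos v ↑ˡ E else suc (suc m) ↑ʳ index (arc v)
  ↑ˡ≢↑ʳ : ∀ {i : Fin (suc (suc m))} {j} → i ↑ˡ E ≢ suc (suc m) ↑ʳ j
  ↑ˡ≢↑ʳ {i} {j} eq with trans (sym (Fin.splitAt-↑ˡ (suc (suc m)) i E)) (trans (cong (splitAt (suc (suc m))) eq) (Fin.splitAt-↑ʳ (suc (suc m)) E j))
  ... | ()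
  inj : ∀ u v → f u ≡ f v → u ≡ v
  inj u v eq with side u in su | side v in sv
  ... | true  | true  = pos-inj (∈L u) (∈L v) su sv (Fin.↑ˡ-injective E _ _ eq)
  ... | true  | false = contradiction eq ↑ˡ≢↑ʳ
  ... | false | true  = contradiction (sym eq) ↑ˡ≢↑ʳ
  ... | false | false = arc-inj (∈L u) (∈L v) su sv (index-inj (Fin.↑ʳ-injective (suc (suc m)) _ _ eq))
  inc : ∀ i e → Incident T i e → 1-subdivision G ⊢ (i ↑ˡ E) ~ (suc (suc m) ↑ʳ index e)
  inc i e r = bipartite-adj _ i (index e) (case incident⇒end T r of λ
    { (inj₁ eq) → inj₁ (trans eq (cong proj₁ (index-ends e))) ; (inj₂ eq) → inj₂ (trans eq (cong proj₂ (index-ends e))) })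
  adj : ∀ u v → F ⊢ u ~ v → 1-subdivision G ⊢ f u ~ f v
  adj u v r with side u in su | side v in sv | proj₁ sided u v r
  ... | true  | true  | ne = contradiction refl ne
  ... | true  | false | _  = inc _ _ (adj⇒inc (∈L u) (∈L v) su sv r)
  ... | false | true  | _  = Graph.~-sym (1-subdivision G) {pos v ↑ˡ E} {suc (suc m) ↑ʳ index (arc u)} (inc _ _ (adj⇒inc (∈L v) (∈L u) sv su (Graph.~-sym F r)))
  ... | false | false | ne = contradiction refl ne

-- The sides are the parts of the 1-subdivision, and a subdivision vertex has only two neighbours.
-- Here `X` is a given tree in one application and a complete graph in the other.
subgraph⇒sided : ∀ {F X} → F IsSubgraphOf (1-subdivision X) → ∃ (Sided F)
subgraph⇒sided {F} {X} (f , f-inj , hom) = side , adj , deg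
  where
  isVertex : V X ⊎ Fin (length (edges X)) → Bool
  isVertex (inj₁ _) = true
  isVertex (inj₂ _) = false
  at : V F → V X ⊎ Fin (length (edges X))
  at v = splitAt (order X) (f v)
  at-inj : ∀ {u v} → at u ≡ at v → u ≡ v
  at-inj {u} {v} eq = f-inj (trans (sym (Fin.join-splitAt (order X) _ (f u)))
    (trans (cong (Fin.join (order X) _) eq) (Fin.join-splitAt (order X) _ (f v))))
  side : V F → Bool
  side v = isVertex (at v)
  adj : ∀ u v → F ⊢ u ~ v → side u ≢ side v
  adj u v r with at u | at v | hom r
  ... | inj₁ _ | inj₂ _ | _ = λ ()
  ... | inj₂ _ | inj₁ _ | _ = λ ()
  ends : ∀ {x b e} → at b ≡ inj₂ e → F ⊢ x ~ b →
    at x ≡ inj₁ (proj₁ (lookup (edges X) e)) ⊎ at x ≡ inj₁ (proj₂ (lookup (edges X) e))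
  ends {x} {b} eb r with at x | at b | hom r
  ends refl r | inj₁ _ | inj₂ _ | inj₁ refl = inj₁ refl
  ends refl r | inj₁ _ | inj₂ _ | inj₂ refl = inj₂ refl
  deg : ∀ b → side b ≡ false → ∀ x y z → F ⊢ x ~ b → F ⊢ y ~ b → F ⊢ z ~ b → x ≡ y ⊎ y ≡ z ⊎ x ≡ z
  deg b sb x y z xb yb zb with at b in eb
  ... | inj₂ e with ends eb xb | ends eb yb | ends eb zb
  ...   | inj₁ p | inj₁ q | _ = inj₁ (at-inj (trans p (sym q)))
  ...   | inj₂ p | inj₂ q | _ = inj₁ (at-inj (trans p (sym q)))
  ...   | inj₁ p | inj₂ q | inj₁ s = inj₂ (inj₂ (at-inj (trans p (sym s))))
  ...   | inj₁ p | inj₂ q | inj₂ s = inj₂ (inj₁ (at-inj (trans q (sym s))))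
  ...   | inj₂ p | inj₁ q | inj₁ s = inj₂ (inj₁ (at-inj (trans q (sym s))))
  ...   | inj₂ p | inj₁ q | inj₂ s = inj₂ (inj₂ (at-inj (trans p (sym s))))

-- Bounded clique number and the sufficiency of both conditions

unique⇒length≤∣∣ : ∀ {n xs} (S : Subset n) → Unique xs → (∀ {x} → x ∈ xs → x Subset.∈ S) → length xs ≤ ∣ S ∣
unique⇒length≤∣∣ {xs = []} S _ _ = z≤n
unique⇒length≤∣∣ {xs = x ∷ xs} S u@(_ ∷ u′) xs⊆S = ≤-<-trans
  (unique⇒length≤∣∣ (S Subset.- x) u′ λ {y} y∈ → Subset.x∈p∧x≢y⇒x∈p-y (xs⊆S (there y∈)) λ { refl → unique-∉ u y∈ })
  (Subset.x∈p⇒∣p-x∣<∣p∣ (xs⊆S (here refl)))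

clique⇒length≤ : ∀ G {w xs} → IsCliqueNumber G w → Unique xs →
  (∀ {x y} → x ∈ xs → y ∈ xs → x ≢ y → G ⊢ x ~ y) → length xs ≤ w
clique⇒length≤ G {xs = xs} (_ , bound) u clique = ≤-trans
  (unique⇒length≤∣∣ S u (∈-subset⁺ (_∈? xs)))
  (bound S λ u∈ v∈ → clique (∈-subset⁻ (_∈? xs) u∈) (∈-subset⁻ (_∈? xs) v∈))
  where S = subset (_∈? xs)

large⇒independent : ∀ G {w} → IsCliqueNumber G w → ∀ t {xs} → Unique xs → ramsey-bound (suc w) t ≤ length xs →
  Σ[ h ∈ (Fin t → V G) ] Injective _≡_ _≡_ h × (∀ i → h i ∈ xs) × (∀ i j → ¬ (G ⊢ h i ~ h j))
large⇒independent G {w} cn t {xs} u large with ramsey (Graph._~?_ G) (Graph.~-sym G) (suc w) t xs u large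
... | inj₁ (ys , len , uys , _ , clique) = contradiction (clique⇒length≤ G cn uys clique) (<⇒≱ (≤-reflexive (sym len)))
... | inj₂ (ys , refl , uys , ys⊆xs , indep) = lookup ys , lookup-unique uys , (λ i → ys⊆xs (∈-lookup i)) , non
  where
  non : ∀ i j → ¬ (G ⊢ lookup ys i ~ lookup ys j)
  non i j r = indep (∈-lookup i) (∈-lookup j) (λ eq → Graph.~-irrefl G (subst (G ⊢ _ ~_) (sym eq) r)) r

K-induced : ∀ G {r t} (g : Fin r → V G) (h : Fin t → V G) → Injective _≡_ _≡_ g → Injective _≡_ _≡_ h →
  (∀ i j → ¬ (G ⊢ g i ~ g j)) → (∀ i j → ¬ (G ⊢ h i ~ h j)) → (∀ i j → G ⊢ g i ~ h j) →
  K r t IsInducedSubgraphOf G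
K-induced G {r} {t} g h g-inj h-inj gg hh gh = (λ u → f (splitAt r u)) , inj , λ u v → mk⇔ (adj⁺ (splitAt r u) (splitAt r v)) (adj⁻ (splitAt r u) (splitAt r v))
  where
  open Graph G using (~-sym; ~-irrefl)
  f : Fin r ⊎ Fin t → V G
  f = [ g , h ]′
  g≢h : ∀ {i j} → g i ≢ h j
  g≢h {i} {j} eq = ~-irrefl (subst (_⊢_~_ G (g i)) (sym eq) (gh i j))
  f-inj : ∀ x y → f x ≡ f y → x ≡ y
  f-inj (inj₁ i) (inj₁ j) eq = cong inj₁ (g-inj eq)
  f-inj (inj₁ i) (inj₂ j) eq = contradiction eq g≢h
  f-inj (inj₂ i) (inj₁ j) eq = contradiction (sym eq) g≢h
  f-inj (inj₂ i) (inj₂ j) eq = cong inj₂ (h-inj eq)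
  inj : Injective _≡_ _≡_ (λ u → f (splitAt r u))
  inj {u} {v} eq = trans (sym (Fin.join-splitAt r t u))
    (trans (cong (Fin.join r t) (f-inj (splitAt r u) (splitAt r v) eq)) (Fin.join-splitAt r t v))
  adj⁺ : ∀ x y → BipartiteAdj {r} {t} (λ _ _ → ⊤) x y → G ⊢ f x ~ f y
  adj⁺ (inj₁ i) (inj₂ j) _ = gh i j
  adj⁺ (inj₂ j) (inj₁ i) _ = ~-sym (gh i j)
  adj⁻ : ∀ x y → G ⊢ f x ~ f y → BipartiteAdj {r} {t} (λ _ _ → ⊤) x y
  adj⁻ (inj₁ i) (inj₁ j) r = gg i j r
  adj⁻ (inj₁ i) (inj₂ j) _ = tt
  adj⁻ (inj₂ i) (inj₁ j) _ = tt
  adj⁻ (inj₂ i) (inj₂ j) r = hh i j r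

-- Ramsey's theorem makes both sides of a large biclique independent; `r` vertices of one side and
-- `t` of the other then induce the forbidden graph.
K-free⇒biclique-free : ∀ G {r t w} → r ≤ t → (K r t -Free) G → IsCliqueNumber G w →
  Biclique-free (G ⊢_~_) (ramsey-bound (suc w) t)
K-free⇒biclique-free G {r} {t} r≤t K-free cn R M uR uM R-large M-large rel
  with g , g-inj , g∈ , gg ← large⇒independent G cn t uR R-large
  with h , h-inj , h∈ , hh ← large⇒independent G cn t uM M-large =
  K-free (K-induced G (λ i → g (Fin.inject≤ i r≤t)) h
    (λ eq → Fin.inject≤-injective r≤t r≤t _ _ (g-inj eq)) h-inj
    (λ i j → gg _ _) hh (λ i j → rel (g∈ _) (h∈ j)))

K₁-free⇒degree≤ : ∀ G {t w} → (K 1 t -Free) G → IsCliqueNumber G w → ∀ v →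
  length (filter (Graph._~?_ G v) (all G)) ≤ ramsey-bound (suc w) t
K₁-free⇒degree≤ G {t} K-free cn v = ≮⇒≥ λ large →
  let h , h-inj , h∈ , hh = large⇒independent G cn t (Unique.filter⁺ (Graph._~?_ G v) (Unique.allFin⁺ _)) (<⇒≤ large) in
  K-free (K-induced G (λ _ → v) h (λ { {zero} {zero} _ → refl }) h-inj (λ _ _ → Graph.~-irrefl G) hh
    (λ _ j → proj₂ (∈-filter⁻ (Graph._~?_ G v) {xs = all G} (h∈ j))))

star-forbidden⇒bounded : ∀ {T t} → χₛ-Bounded ⟨ T , K 1 t ⟩-Free
star-forbidden⇒bounded {T} {t} = (λ w → let D = ramsey-bound (suc w) t in suc (D + D * D) * suc (D + D * D)) ,
  λ G (_ , K-free) w k cn (_ , least) →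
    let open Graph G using (_~?_; ~-sym)
        c , good = bounded-degree-coloring G (λ v → filter (v ~?_) (all G)) (K₁-free⇒degree≤ G K-free cn)
          (λ {u} {v} r → ∈-filter⁺ (v ~?_) (∈-all G) (~-sym r))
    in least _ (c , good⇒star G c good)

sided⇒bounded : ∀ {T side r t} → Sided T side → IsForest T → r ≤ t → χₛ-Bounded ⟨ T , K r t ⟩-Free
sided⇒bounded {T} {side} {r} {t} sided forest r≤t
  with L , ∈L , m , S , pos , arc , P ← sided-forest⇒placement T side sided forest =
  (λ w → star-bound (ramsey-bound (suc w) t) S) , λ G (T-free , K-free) w k cn (_ , least) →
    case subdivisionIn-or-coloring G (K-free⇒biclique-free G r≤t K-free cn) S of λ
    { (inj₁ C) → contradiction (placed⇒induced sided ∈L P C) T-free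
    ; (inj₂ (c , good)) → least _ (c , good⇒star G c good) }

-- 1-subdivisions of complete graphs

elements : ∀ {n} (S : Subset n) → ∃[ xs ] Unique xs × length xs ≡ ∣ S ∣ × (∀ {x} → x ∈ xs → x Subset.∈ S)
elements Vec.[] = [] , [] , refl , λ ()
elements (outside Vec.∷ S) with xs , u , len , xs⊆ ← elements S =
  map suc xs , Unique.map⁺ Fin.suc-injective u , trans (length-map suc xs) len ,
  λ x∈ → case ∈-map⁻ suc x∈ of λ { (y , y∈ , refl) → Vec.there (xs⊆ y∈) }
elements (inside Vec.∷ S) with xs , u , len , xs⊆ ← elements S =
  zero ∷ map suc xs , unique-∷ (λ z∈ → case ∈-map⁻ suc z∈ of λ ()) (Unique.map⁺ Fin.suc-injective u) ,
  cong suc (trans (length-map suc xs) len) ,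
  λ { (here refl) → Vec.here ; (there x∈) → case ∈-map⁻ suc x∈ of λ { (y , y∈ , refl) → Vec.there (xs⊆ y∈) } }

complete : ℕ → Graph
complete n = record
  { order = n ; _~_ = _≢_ ; _~?_ = λ u v → ¬? (u Fin.≟ v) ; ~-sym = λ u≢v → u≢v ∘ sym ; ~-irrefl = λ v≢v → v≢v refl }

module _ (n : ℕ) where

  private
    X = complete n
    G = 1-subdivision X
    E = length (edges X)

  open Graph G using (~-sym)

  Joins : Fin n → Fin E → Set
  Joins i e = i ≡ proj₁ (lookup (edges X) e) ⊎ i ≡ proj₂ (lookup (edges X) e)

  joins-two : ∀ {i j l e} → Joins i e → Joins j e → Joins l e → i ≢ j → j ≢ l → i ≡ l
  joins-two (inj₁ p) (inj₁ q) _ ne _ = contradiction (trans p (sym q)) ne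
  joins-two (inj₂ p) (inj₂ q) _ ne _ = contradiction (trans p (sym q)) ne
  joins-two _ (inj₁ p) (inj₁ q) _ ne = contradiction (trans p (sym q)) ne
  joins-two _ (inj₂ p) (inj₂ q) _ ne = contradiction (trans p (sym q)) ne
  joins-two (inj₁ p) (inj₂ _) (inj₁ q) _ _ = trans p (sym q)
  joins-two (inj₂ p) (inj₁ _) (inj₂ q) _ _ = trans p (sym q)

  ordered : ∀ e → proj₁ (lookup (edges X) e) Fin.< proj₂ (lookup (edges X) e)
  ordered e = proj₁ (proj₂ (∈-filter⁻ _ {xs = cartesianProduct (allFin n) (allFin n)} (∈-lookup e)))

  edges-unique : Unique (edges X)
  edges-unique = Unique.filter⁺ _ (Unique.cartesianProduct⁺ (Unique.allFin⁺ n) (Unique.allFin⁺ n))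

  joins-inj : ∀ {i j e f} → Joins i e → Joins j e → Joins i f → Joins j f → i ≢ j → e ≡ f
  joins-inj (inj₁ p) (inj₁ q) _ _ ne = contradiction (trans p (sym q)) ne
  joins-inj (inj₂ p) (inj₂ q) _ _ ne = contradiction (trans p (sym q)) ne
  joins-inj _ _ (inj₁ p) (inj₁ q) ne = contradiction (trans p (sym q)) ne
  joins-inj _ _ (inj₂ p) (inj₂ q) ne = contradiction (trans p (sym q)) ne
  joins-inj (inj₁ p) (inj₂ q) (inj₁ p′) (inj₂ q′) _ =
    lookup-unique edges-unique (cong₂ _,_ (trans (sym p) p′) (trans (sym q) q′))
  joins-inj (inj₂ p) (inj₁ q) (inj₂ p′) (inj₁ q′) _ =
    lookup-unique edges-unique (cong₂ _,_ (trans (sym q) q′) (trans (sym p) p′))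
  -- The same pair cannot be listed in both orders.
  joins-inj {e = e} {f} (inj₁ p) (inj₂ q) (inj₂ p′) (inj₁ q′) _ =
    contradiction (subst₂ Fin._<_ (trans (sym q′) q) (trans (sym p′) p) (ordered f)) (<-asym (ordered e))
  joins-inj {e = e} {f} (inj₂ p) (inj₁ q) (inj₁ p′) (inj₂ q′) _ =
    contradiction (subst₂ Fin._<_ (trans (sym p′) p) (trans (sym q′) q) (ordered f)) (<-asym (ordered e))

  link : ∀ {i j} → i ≢ j → ∃[ e ] Joins i e × Joins j e
  link {i} {j} i≢j with <-cmp (toℕ i) (toℕ j)
  ... | B.tri< i<j _ _ = let ij∈ = ∈-edges X i<j i≢j in
        Any.index ij∈ , inj₁ (cong proj₁ (lookup-index ij∈)) , inj₂ (cong proj₂ (lookup-index ij∈))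
  ... | B.tri≈ _ i≡j _ = contradiction (Fin.toℕ-injective i≡j) i≢j
  ... | B.tri> _ _ j<i = let ji∈ = ∈-edges X j<i (i≢j ∘ sym) in
        Any.index ji∈ , inj₂ (cong proj₂ (lookup-index ji∈)) , inj₁ (cong proj₁ (lookup-index ji∈))

  main : Fin n → V G
  main i = i ↑ˡ E

  middle-of : Fin E → V G
  middle-of e = n ↑ʳ e

  main~middle : ∀ {i e} → Joins i e → G ⊢ main i ~ middle-of e
  main~middle {i} {e} j = bipartite-adj Joins i e j

  -- Two branch vertices have at most one subdivision vertex in common.
  no-4-cycle : ∀ {a b c d} → G ⊢ a ~ b → G ⊢ b ~ c → G ⊢ c ~ d → G ⊢ d ~ a → a ≡ c ⊎ b ≡ d
  no-4-cycle {a} {b} {c} {d} ab bc cd da = case go (splitAt n a) (splitAt n b) (splitAt n c) (splitAt n d) ab bc cd da of λ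
    { (inj₁ eq) → inj₁ (splitAt-inj eq) ; (inj₂ eq) → inj₂ (splitAt-inj eq) }
    where
    splitAt-inj : ∀ {u v} → splitAt n u ≡ splitAt n v → u ≡ v
    splitAt-inj {u} {v} eq = trans (sym (Fin.join-splitAt n E u)) (trans (cong (Fin.join n E) eq) (Fin.join-splitAt n E v))
    Adj = BipartiteAdj Joins
    go : ∀ a b c d → Adj a b → Adj b c → Adj c d → Adj d a → a ≡ c ⊎ b ≡ d
    go (inj₁ i) (inj₂ e) (inj₁ j) (inj₂ f) ab bc cd da with i Fin.≟ j
    ... | yes i≡j = inj₁ (cong inj₁ i≡j)
    ... | no  i≢j = inj₂ (cong inj₂ (joins-inj ab bc da cd i≢j))
    go (inj₂ e) (inj₁ i) (inj₂ f) (inj₁ j) ab bc cd da with i Fin.≟ j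
    ... | yes i≡j = inj₂ (cong inj₁ i≡j)
    ... | no  i≢j = inj₁ (cong inj₂ (joins-inj ab da bc cd i≢j))

  no-triangle : ∀ {a b c} → G ⊢ a ~ b → G ⊢ b ~ c → ¬ (G ⊢ a ~ c)
  no-triangle {a} {b} {c} ab bc ac = go (splitAt n a) (splitAt n b) (splitAt n c) ab bc ac
    where
    Adj = BipartiteAdj Joins
    go : ∀ a b c → Adj a b → Adj b c → ¬ Adj a c
    go (inj₁ _) (inj₂ _) (inj₁ _) _ _ ()
    go (inj₂ _) (inj₁ _) (inj₂ _) _ _ ()

  K-free : ∀ {r t} → 2 ≤ r → 2 ≤ t → (K r t -Free) G
  K-free {suc (suc r)} {suc (suc t)} (s≤s (s≤s _)) (s≤s (s≤s _)) (f , inj , adj) =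
    case no-4-cycle (go u₀ v₀) (~-sym {f (u₁ ↑ˡ T)} {f (R ↑ʳ v₀)} (go u₁ v₀)) (go u₁ v₁) (~-sym {f (u₀ ↑ˡ T)} {f (R ↑ʳ v₁)} (go u₀ v₁)) of λ
    { (inj₁ eq) → case Fin.↑ˡ-injective T u₀ u₁ (inj eq) of λ ()
    ; (inj₂ eq) → case Fin.↑ʳ-injective R v₀ v₁ (inj eq) of λ () }
    where
    R T : ℕ
    R = suc (suc r)
    T = suc (suc t)
    u₀ u₁ : Fin R
    u₀ = zero
    u₁ = suc zero
    v₀ v₁ : Fin T
    v₀ = zero
    v₁ = suc zero
    go : ∀ i j → G ⊢ f (i ↑ˡ T) ~ f (R ↑ʳ j)
    go i j = Equivalence.to (adj (i ↑ˡ T) (R ↑ʳ j)) (bipartite-adj (λ _ _ → ⊤) i j tt)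

  clique≤2 : ∀ S → IsClique G S → ∣ S ∣ ≤ 2
  clique≤2 S clique with elements S
  ... | [] , _ , len , _ = subst (_≤ 2) len z≤n
  ... | _ ∷ [] , _ , len , _ = subst (_≤ 2) len (s≤s z≤n)
  ... | _ ∷ _ ∷ [] , _ , len , _ = subst (_≤ 2) len ≤-refl
  ... | x ∷ y ∷ z ∷ _ , (x≢y ∷ x≢z ∷ _) ∷ (y≢z ∷ _) ∷ _ , _ , ∈S = contradiction
    (clique (∈S (here refl)) (∈S (there (there (here refl)))) x≢z)
    (no-triangle (clique (∈S (here refl)) (∈S (there (here refl))) x≢y)
                 (clique (∈S (there (here refl))) (∈S (there (there (here refl)))) y≢z))

  clique-number : ∀ {i j : Fin n} → i ≢ j → IsCliqueNumber G 2
  clique-number {i} {j} i≢j = (S , clique , ≤-antisym (clique≤2 S clique) (unique⇒length≤∣∣ S unique (∈-subset⁺ (_∈? uv)))) , clique≤2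
    where
    e = proj₁ (link i≢j)
    uv : List (V G)
    uv = main i ∷ middle-of e ∷ []
    r : G ⊢ main i ~ middle-of e
    r = main~middle (proj₁ (proj₂ (link i≢j)))
    unique : Unique uv
    unique = unique-∷ (λ { (here eq) → Graph.~-irrefl G {main i} (subst (G ⊢ main i ~_) (sym eq) r) }) (unique-∷ (λ ()) [])
    S = subset (_∈? uv)
    clique : IsClique G S
    clique u∈ v∈ u≢v with ∈-subset⁻ (_∈? uv) u∈ | ∈-subset⁻ (_∈? uv) v∈
    ... | here refl | here refl = contradiction refl u≢v
    ... | here refl | there (here refl) = r
    ... | there (here refl) | here refl = ~-sym {main i} {middle-of e} r
    ... | there (here refl) | there (here refl) = contradiction refl u≢v

  -- k + 2 branch vertices of the same colour exist by pigeonhole; among the k + 1 edges from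
  -- one of them to the others two have subdivision vertices of the same colour.
  not-star-colorable : ∀ {k} → k * suc k < n → ¬ StarColorable G k
  not-star-colorable {k} large (c , star) with Fin.any? (λ α → suc k <? length (class α))
    where
    class : Fin k → List (Fin n)
    class α = filter (λ i → c (main i) Fin.≟ α) (allFin n)
  ... | no ¬p =
    let i , _ , away = avoid (λ α i → c (main i) Fin.≟ α) (allFin k) (allFin n) (λ {α} _ → ≮⇒≥ λ l → ¬p (α , l))
          (subst₂ (λ a b → a * suc k < b) (sym (length-tabulate {n = k} id)) (sym (length-tabulate {n = n} id)) large)
    in away (∈-allFin (c (main i))) refl
  ... | yes (α , long) = finish (class α) refl (Unique.filter⁺ _ (Unique.allFin⁺ n)) long
    where
    class : Fin k → List (Fin n)
    class α = filter (λ i → c (main i) Fin.≟ α) (allFin n)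
    finish : ∀ xs → xs ≡ class α → Unique xs → suc k < length xs → ⊥
    finish (x ∷ xs) eq u@(_ ∷ u′) (s≤s long) with repeated col u′ long
      where
      col : Fin n → Fin k
      col y with y Fin.≟ x
      -- A default value at `x`, which does not occur in `xs`.
      ... | yes _ = α
      ... | no y≢x = c (middle-of (proj₁ (link y≢x)))
    ... | y , z , y∈ , z∈ , y≢z , same with y Fin.≟ x | z Fin.≟ x
    ...   | yes refl | _ = unique-∉ u y∈
    ...   | no _ | yes refl = unique-∉ u z∈
    ...   | no y≢x | no z≢x with link y≢x | link z≢x
    ...     | e , ye , xe | f , zf , xf = star⇒no-bicoloured-path G c star
              {main y} {middle-of e} {main x} {middle-of f}
              (main~middle ye) (~-sym {main x} {middle-of e} (main~middle xe)) (main~middle xf)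
              (trans (col-α (there y∈)) (sym (col-α (here refl)))) same
              (λ eq → y≢x (Fin.↑ˡ-injective E _ _ eq))
              (λ eq → y≢z (joins-two ye xe (subst (Joins z) (sym (Fin.↑ʳ-injective n _ _ eq)) zf) y≢x (z≢x ∘ sym)))
      where
      col-α : ∀ {i} → i ∈ x ∷ xs → c (main i) ≡ α
      col-α i∈ = proj₂ (∈-filter⁻ _ {xs = allFin n} (subst (_ ∈_) eq i∈))

-- `χₛ-Bounded` speaks of the least number of colours. Its existence under double negation is enough
-- to derive a contradiction.
¬¬-least : ∀ {P : ℕ → Set} {n} → P n → ¬ ¬ (∃[ m ] P m × (∀ k → P k → m ≤ k))
¬¬-least {P} {n} p none = below (suc n) n ≤-refl p
  where
  below : ∀ m k → k < m → ¬ P k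
  below (suc m) k k<1+m q = none (k , q , λ j pj → ≮⇒≥ λ j<k → below m j (<-≤-trans j<k (s≤s⁻¹ k<1+m)) pj)

star-colorable-order : ∀ G → StarColorable G (order G)
star-colorable-order G = id , good⇒star G id ((λ { r refl → Graph.~-irrefl G r }) , λ _ _ _ eq _ → inj₁ eq)

sided-cong : ∀ {F side side′} → (∀ v → side v ≡ side′ v) → Sided F side → Sided F side′
sided-cong eq (adj , deg) = (λ u v r p → adj u v r (trans (eq u) (trans p (sym (eq v))))) , λ b sb → deg b (trans (eq b) sb)

-- There are finitely many choices of sides, so it is decidable whether one fits. If none does, the
-- class contains the 1-subdivisions of all complete graphs, and `f 2` would bound their star
-- chromatic numbers.
bounded⇒sided : ∀ {T r t} → 2 ≤ r → r ≤ t → χₛ-Bounded ⟨ T , K r t ⟩-Free → ∃ (Sided T)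
bounded⇒sided {T} {r} {t} 2≤r r≤t (f , bound) with Subset.anySubset? (λ S → sided? T (Vec.lookup S))
... | yes (S , sided) = Vec.lookup S , sided
... | no unsided = ⊥-elim (¬¬-least (star-colorable-order G) λ (k , colorable , least) →
    let k≤M = bound G (T-free , K-free n 2≤r (≤-trans 2≤r r≤t)) 2 k (clique-number n {zero} {suc zero} λ ()) (colorable , least)
    in not-star-colorable n (s≤s (≤-trans (*-mono-≤ k≤M (s≤s k≤M)) (n≤1+n _))) colorable)
  where
  -- This exceeds `k * suc k` for every `k` up to `f 2`, and it is at least 2, so that an edge
  -- exists and the clique number is 2.
  n = suc (suc (f 2 * suc (f 2)))
  G = 1-subdivision (complete n)
  T-free : (T -Free) G
  T-free (g , inj , adj) =
    let side , sided = subgraph⇒sided {T} {complete n} (g , inj , λ {u} {v} → Equivalence.to (adj u v)) in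
    unsided (Vec.tabulate side , sided-cong {T} (λ v → sym (Vec.lookup∘tabulate side v)) sided)

theorem1 : (T : Graph) → IsForest T → (r t : ℕ) → 1 ≤ r → r ≤ t →
    χₛ-Bounded ⟨ T , K r t ⟩-Free ⇔
    (r ≡ 1 ⊎ (∃[ S ] (IsTree S × T IsSubgraphOf (1-subdivision S))))
theorem1 T forest r t 1≤r r≤t = mk⇔ forward backward
  where
  forward : χₛ-Bounded ⟨ T , K r t ⟩-Free → r ≡ 1 ⊎ (∃[ S ] (IsTree S × T IsSubgraphOf (1-subdivision S)))
  forward bounded with r ≟ 1
  ... | yes r≡1 = inj₁ r≡1
  ... | no  r≢1
    with side , sided ← bounded⇒sided {T} {r} {t} (≤∧≢⇒< 1≤r (r≢1 ∘ sym)) r≤t bounded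
    with L , ∈L , _ , S , _ , _ , P ← sided-forest⇒placement T side sided forest =
    inj₂ (treeGraph S , treeGraph-isTree S , placed⇒subgraph sided ∈L P)
  backward : r ≡ 1 ⊎ (∃[ S ] (IsTree S × T IsSubgraphOf (1-subdivision S))) → χₛ-Bounded ⟨ T , K r t ⟩-Free
  backward (inj₁ refl) = star-forbidden⇒bounded {T} {t}
  -- From `S` only the sides of `T` are kept; `sided⇒bounded` builds a tree whose 1-subdivision
  -- contains `T` as an induced subgraph.
  backward (inj₂ (S , _ , T⊆S)) =
    let side , sided = subgraph⇒sided {T} {S} T⊆S in sided⇒bounded {T} {side} {r} {t} sided forest r≤t
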